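{- Let $P_{\mathcal G}(q)=\sum_{\pi}q^{|\pi|}$, summed over all integer partitions $\pi$ (including the empty one) in which any two consecutive parts differ by at least $2$, and any two consecutive parts that are both even differ by at least $4$. Then $$P_{\mathcal G}(q)=\sum_{n\ge0}\frac{(-q;q^2)_n\,q^{n^2}}{(q^2;q^2)_n}=\frac{1}{(q;q^8)_\infty(q^4;q^8)_\infty(q^7;q^8)_\infty}.$$
   Context: $(a;q)_n=\prod_{j=0}^{n-1}(1-aq^j)$ and $(a;q)_\infty=\prod_{j\ge0}(1-aq^j)$; $|\pi|$ is the sum of the parts of $\pi$. -}

module Defs where

open import Data.Empty using (⊥-elim)
open import Data.Fin.Base using (Fin; zero; suc; toℕ)
import Data.Fin.Properties as Fin
open import Data.Integer.Base as ℤ using (ℤ; +_; 0ℤ; 1ℤ)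
import Data.Integer.Properties as ℤ
open import Data.List.Base using (List; []; _∷_; [_]; _++_; map; filter; length)
open import Data.List.Membership.Propositional using (_∈_)
open import Data.List.Membership.Propositional.Properties
  using (∈-map⁺; ∈-map⁻; ∈-++⁺ˡ; ∈-++⁺ʳ; ∈-++⁻; ∈-filter⁺; ∈-filter⁻)
open import Data.List.Relation.Unary.All using (All; []; _∷_; all?)
import Data.List.Relation.Unary.AllPairs as AllPairs
open import Data.List.Relation.Unary.Any using (here)
open import Data.List.Relation.Unary.Linked using (Linked; linked?)
open import Data.List.Relation.Unary.Unique.Propositional using (Unique)
import Data.List.Relation.Unary.Unique.Propositional.Properties as Unique
open import Data.Nat.Base as ℕ using (ℕ; zero; suc; z≤n; s≤s; s≤s⁻¹; ∣_-_∣)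
import Data.Nat.Properties as ℕ
open import Data.Nat.Divisibility using (_∣_; _∣?_)
open import Data.Nat.ListAction using (sum)
open import Data.Product using (_×_; _,_; ∃-syntax; proj₁; proj₂)
open import Data.Sum using (inj₁; inj₂)
open import Function.Base using (_∘_)
open import Function.Bundles using (_⇔_; mk⇔)
open import Relation.Binary.PropositionalEquality
  using (_≡_; refl; sym; trans; cong; cong₂; subst; module ≡-Reasoning)
open import Relation.Nullary.Decidable using (yes; no; _×-dec_; _→-dec_)
open import Relation.Unary using (Pred; Decidable)

open import Algebra.Properties.Semiring.Sum ℤ.+-*-semiring
  using (sum-syntax; sum-cong-≗; sum-replicate-zero; ∑-distrib-+)

------------------------------------------------------------------------
-- Formal power series in q over ℤ, given by their coefficients

Series : Set
Series = ℕ → ℤ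

infix  4 _≈_ _⟶_
infixl 6 _+_ _-_
infixl 7 _*_ _/_
infix  8 -_
infixr 8 _^_

_≈_ : Series → Series → Set
f ≈ g = ∀ k → f k ≡ g k

0# 1# q : Series
0# _             = 0ℤ
1# zero          = 1ℤ
1# (suc _)       = 0ℤ
q zero           = 0ℤ
q (suc zero)     = 1ℤ
q (suc (suc _))  = 0ℤ

_+_ _-_ _*_ : Series → Series → Series
(f + g) k = f k ℤ.+ g k
(f - g) k = f k ℤ.- g k
(f * g) k = ∑[ i < suc k ] (f (toℕ i) ℤ.* g (k ℕ.∸ toℕ i))

-_ : Series → Series
(- f) k = ℤ.- f k

_^_ : Series → ℕ → Series
f ^ zero  = 1#
f ^ suc n = f * f ^ n

------------------------------------------------------------------------
-- Limits in the q-adic topology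

_⟶_ : (ℕ → Series) → Series → Set
s ⟶ f = ∀ k → ∃[ m ] (∀ n → m ℕ.≤ n → s n k ≡ f k)

-- This is the limit of s only when the k-th coefficient of s n does not
-- depend on n > k; see lim-correct.

lim : (ℕ → Series) → Series
lim s k = s (suc k) k

∑< : (ℕ → Series) → ℕ → Series
∑< f zero    = 0#
∑< f (suc n) = ∑< f n + f n

∑∞ : (ℕ → Series) → Series
∑∞ f = lim (∑< f)

-- Geometric series: the inverse of f when f has constant coefficient 1;
-- see recip-correct.

recip : Series → Series
recip f = ∑∞ ((1# - f) ^_)

_/_ : Series → Series → Series
f / g = f * recip g

-- ⟨ a ⨾ t ⟩ n is (a;t)ₙ and ⟨ a ⨾ t ⟩∞ is (a;t)_∞; for the convergence of
-- the latter when t has no constant term, see ⟨⨾⟩∞-correct.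

⟨_⨾_⟩_ : Series → Series → ℕ → Series
⟨ a ⨾ t ⟩ zero  = 1#
⟨ a ⨾ t ⟩ suc n = (1# - a * t ^ n) * ⟨ a ⨾ t ⟩ n

⟨_⨾_⟩∞ : Series → Series → Series
⟨ a ⨾ t ⟩∞ = lim (⟨ a ⨾ t ⟩_)

------------------------------------------------------------------------
-- Partitions, with parts listed in weakly decreasing order

IsPartition : Pred (List ℕ) _
IsPartition π = All (0 ℕ.<_) π × Linked ℕ._≥_ π

isPartition? : Decidable IsPartition
isPartition? π = all? (0 ℕ.<?_) π ×-dec linked? ℕ._≥?_ π

𝒢 : Pred (List ℕ) _
𝒢 π = Linked (λ a b → 2 ℕ.≤ ∣ a - b ∣) π
    × Linked (λ a b → 2 ∣ a → 2 ∣ b → 4 ℕ.≤ ∣ a - b ∣) π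

𝒢? : Decidable 𝒢
𝒢? π = linked? (λ a b → 2 ℕ.≤? ∣ a - b ∣) π
  ×-dec linked? (λ a b → (2 ∣? a) →-dec ((2 ∣? b) →-dec (4 ℕ.≤? ∣ a - b ∣))) π

-- The compositions of n + 1, with the first part x stored as x - 1

compositions⁺ : ℕ → List (ℕ × List ℕ)
compositions⁺ zero    = [ 0 , [] ]
compositions⁺ (suc n) =
  map (λ (x , xs) → 0 , suc x ∷ xs) (compositions⁺ n) ++
  map (λ (x , xs) → suc x , xs) (compositions⁺ n)

compositions : ℕ → List (List ℕ)
compositions zero    = [ [] ]
compositions (suc n) = map (λ (x , xs) → suc x ∷ xs) (compositions⁺ n)

-- Each partition of n, exactly once; see ∈-partitions and
-- partitions-unique.

partitions : ℕ → List (List ℕ)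
partitions n = filter isPartition? (compositions n)

P𝒢 : Series
P𝒢 n = + length (filter 𝒢? (partitions n))

------------------------------------------------------------------------

private
  compositions⁺-sound : ∀ n {x xs} → (x , xs) ∈ compositions⁺ n → x ℕ.+ sum xs ≡ n
  compositions⁺-sound zero (here refl) = refl
  compositions⁺-sound (suc n) p with ∈-++⁻ (map _ (compositions⁺ n)) p
  ... | inj₁ p′ with _ , p″ , refl ← ∈-map⁻ _ p′ = cong suc (compositions⁺-sound n p″)
  ... | inj₂ p′ with _ , p″ , refl ← ∈-map⁻ _ p′ = cong suc (compositions⁺-sound n p″)

  compositions⁺-complete : ∀ n {x xs} → All (0 ℕ.<_) xs → x ℕ.+ sum xs ≡ n →
                           (x , xs) ∈ compositions⁺ n
  compositions⁺-complete zero {zero} [] eq = here refl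
  compositions⁺-complete zero {zero} (s≤s _ ∷ _) ()
  compositions⁺-complete (suc n) {zero} (s≤s _ ∷ ps) eq =
    ∈-++⁺ˡ (∈-map⁺ _ (compositions⁺-complete n ps (ℕ.suc-injective eq)))
  compositions⁺-complete (suc n) {suc x} ps eq =
    ∈-++⁺ʳ _ (∈-map⁺ _ (compositions⁺-complete n ps (ℕ.suc-injective eq)))

  compositions⁺-unique : ∀ n → Unique (compositions⁺ n)
  compositions⁺-unique zero    = [] AllPairs.∷ AllPairs.[]
  compositions⁺-unique (suc n) =
    Unique.++⁺ (Unique.map⁺ (λ { refl → refl }) (compositions⁺-unique n))
               (Unique.map⁺ (λ { refl → refl }) (compositions⁺-unique n))
               λ (p , r) → disjoint (∈-map⁻ _ p) (∈-map⁻ _ r)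
    where
    disjoint : ∀ {y} →
      ∃[ z ] (z ∈ compositions⁺ n × y ≡ (0 , suc (proj₁ z) ∷ proj₂ z)) →
      ∃[ z ] (z ∈ compositions⁺ n × y ≡ (suc (proj₁ z) , proj₂ z)) → _
    disjoint (_ , _ , refl) (_ , _ , ())

  compositions-sound : ∀ n {xs} → xs ∈ compositions n → sum xs ≡ n
  compositions-sound zero (here refl) = refl
  compositions-sound (suc n) p with _ , p′ , refl ← ∈-map⁻ _ p =
    cong suc (compositions⁺-sound n p′)

  compositions-complete : ∀ n {xs} → All (0 ℕ.<_) xs → sum xs ≡ n → xs ∈ compositions n
  compositions-complete zero [] eq = here refl
  compositions-complete zero (s≤s _ ∷ _) ()
  compositions-complete (suc n) (s≤s _ ∷ ps) eq =
    ∈-map⁺ _ (compositions⁺-complete n ps (ℕ.suc-injective eq))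

  compositions-unique : ∀ n → Unique (compositions n)
  compositions-unique zero    = [] AllPairs.∷ AllPairs.[]
  compositions-unique (suc n) = Unique.map⁺ (λ { refl → refl }) (compositions⁺-unique n)

∈-partitions : ∀ n {π} → π ∈ partitions n ⇔ (IsPartition π × sum π ≡ n)
∈-partitions n = mk⇔
  (λ p → let p′ , isP = ∈-filter⁻ isPartition? p in isP , compositions-sound n p′)
  (λ (isP , eq) → ∈-filter⁺ isPartition? (compositions-complete n (proj₁ isP) eq) isP)

partitions-unique : ∀ n → Unique (partitions n)
partitions-unique n = Unique.filter⁺ isPartition? (compositions-unique n)

------------------------------------------------------------------------

lim-correct : ∀ s → (∀ k n → k ℕ.< n → s (suc n) k ≡ s n k) → s ⟶ lim s
lim-correct s stable k = suc k , λ n k<n →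
  subst (λ m → s m k ≡ s (suc k) k) (ℕ.m∸n+n≡m k<n) (go (n ℕ.∸ suc k))
  where
  go : ∀ d → s (d ℕ.+ suc k) k ≡ s (suc k) k
  go zero    = refl
  go (suc d) = trans (stable k (d ℕ.+ suc k) (ℕ.m≤n+m (suc k) d)) (go d)

-- f is divisible by q ^ n

Order≥ : ℕ → Series → Set
Order≥ n f = ∀ k → k ℕ.< n → f k ≡ 0ℤ

private
  ∑-zero : ∀ {n} (f : Fin n → ℤ) → (∀ i → f i ≡ 0ℤ) → ∑[ i < n ] f i ≡ 0ℤ
  ∑-zero {n} f f≡0 = trans (sum-cong-≗ f≡0) (sum-replicate-zero n)

Order≥-* : ∀ {m n} f g → Order≥ m f → Order≥ n g → Order≥ (m ℕ.+ n) (f * g)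
Order≥-* {m} {n} f g F G k k<m+n =
  ∑-zero {suc k} _ λ i → term (toℕ i) (s≤s⁻¹ (Fin.toℕ<n i))
  where
  term : ∀ i → i ℕ.≤ k → f i ℤ.* g (k ℕ.∸ i) ≡ 0ℤ
  term i i≤k with i ℕ.<? m
  ... | yes i<m = cong (ℤ._* g (k ℕ.∸ i)) (F i i<m)
  ... | no  i≮m = trans (cong (f i ℤ.*_) (G (k ℕ.∸ i) k∸i<n)) (ℤ.*-zeroʳ (f i))
    where
    k∸i<n : k ℕ.∸ i ℕ.< n
    k∸i<n = ℕ.+-cancelˡ-< i _ _ (subst (ℕ._< i ℕ.+ n) (sym (ℕ.m+[n∸m]≡n i≤k))
      (ℕ.<-≤-trans k<m+n (ℕ.+-monoˡ-≤ n (ℕ.≮⇒≥ i≮m))))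

Order≥-^ : ∀ {m f} → Order≥ m f → ∀ n → Order≥ (n ℕ.* m) (f ^ n)
Order≥-^ F zero    = λ _ ()
Order≥-^ {m} {f} F (suc n) = Order≥-* {m} f (f ^ n) F (Order≥-^ {m} {f} F n)

private
  Order≥-^₁ : ∀ {f} → f 0 ≡ 0ℤ → ∀ n → Order≥ n (f ^ n)
  Order≥-^₁ {f} f₀ n =
    subst (λ m → Order≥ m (f ^ n)) (ℕ.*-identityʳ n) (Order≥-^ {1} {f} F n)
    where
    F : Order≥ 1 f
    F zero    _ = f₀
    F (suc _) (s≤s ())

  q^n-order : ∀ n → Order≥ n (q ^ n)
  q^n-order = Order≥-^₁ {q} refl

  *-agree : ∀ {f} g k → (∀ i → i ℕ.≤ k → f i ≡ 1# i) → (f * g) k ≡ g k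
  *-agree {f} g k f≡1 = begin
    f 0 ℤ.* g k ℤ.+ rest  ≡⟨ cong₂ ℤ._+_ (cong (ℤ._* g k) (f≡1 0 z≤n)) rest≡0 ⟩
    1ℤ ℤ.* g k ℤ.+ 0ℤ     ≡⟨ ℤ.+-identityʳ _ ⟩
    1ℤ ℤ.* g k            ≡⟨ ℤ.*-identityˡ _ ⟩
    g k                   ∎
    where
    open ≡-Reasoning
    rest = ∑[ i < k ] (f (suc (toℕ i)) ℤ.* g (k ℕ.∸ suc (toℕ i)))
    rest≡0 : rest ≡ 0ℤ
    rest≡0 = ∑-zero {k} _ λ i →
      cong (ℤ._* g (k ℕ.∸ suc (toℕ i))) (f≡1 (suc (toℕ i)) (Fin.toℕ<n i))

∑∞-correct : ∀ f → (∀ n → Order≥ n (f n)) → ∑< f ⟶ ∑∞ f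
∑∞-correct f F = lim-correct (∑< f) λ k n k<n →
  trans (cong (λ z → ∑< f n k ℤ.+ z) (F n k k<n)) (ℤ.+-identityʳ _)

summand-order : ∀ f g n → Order≥ n (f * q ^ (n ℕ.^ 2) / g)
summand-order f g n k k<n =
  subst (λ m → Order≥ m (f * q ^ (n ℕ.^ 2) / g)) (ℕ.+-identityʳ (n ℕ.^ 2))
    (Order≥-* {n ℕ.^ 2} {0} (f * q ^ (n ℕ.^ 2)) (recip g)
      (Order≥-* {0} {n ℕ.^ 2} f (q ^ (n ℕ.^ 2)) (λ _ ()) (q^n-order (n ℕ.^ 2))) (λ _ ()))
    k (ℕ.<-≤-trans k<n (n≤n² n))
  where
  n≤n² : ∀ n → n ℕ.≤ n ℕ.^ 2
  n≤n² zero    = z≤n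
  n≤n² (suc n) = ℕ.m≤m*n (suc n) (suc n ℕ.^ 1)
    {{ℕ.m^n≢0 (suc n) 1}}

⟨⨾⟩∞-correct : ∀ a t → t 0 ≡ 0ℤ → (⟨ a ⨾ t ⟩_) ⟶ ⟨ a ⨾ t ⟩∞
⟨⨾⟩∞-correct a t t₀ = lim-correct (⟨ a ⨾ t ⟩_) λ k n k<n →
  *-agree {1# - a * t ^ n} (⟨ a ⨾ t ⟩ n) k λ i i≤k →
    trans (cong (λ z → 1# i ℤ.- z)
            (Order≥-* {0} {n} a (t ^ n) (λ _ ()) (Order≥-^₁ {t} t₀ n) i (ℕ.≤-<-trans i≤k k<n)))
          (ℤ.+-identityʳ (1# i))

recip-correct : ∀ f → f 0 ≡ 1ℤ → f * recip f ≈ 1#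
recip-correct f f₀ k = begin
  (f * recip f) k          ≡⟨ sum-cong-≗ {suc k} (λ i → cong (f (toℕ i) ℤ.*_) (stable i)) ⟩
  (f * P (suc k)) k        ≡⟨ telescope (suc k) ⟩
  1# k ℤ.- (h ^ suc k) k   ≡⟨ cong (λ z → 1# k ℤ.- z) (h^n-order (suc k) k ℕ.≤-refl) ⟩
  1# k ℤ.- 0ℤ              ≡⟨ ℤ.+-identityʳ _ ⟩
  1# k                     ∎
  where
  open ≡-Reasoning
  h = 1# - f
  P = ∑< (h ^_)

  h^n-order : ∀ n → Order≥ n (h ^ n)
  h^n-order = Order≥-^₁ {h} (cong (λ z → 1ℤ ℤ.- z) f₀)

  stable : ∀ (i : Fin (suc k)) →
           recip f (k ℕ.∸ toℕ i) ≡ P (suc k) (k ℕ.∸ toℕ i)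
  stable i = sym (partial (k ℕ.∸ toℕ i) (suc k) (s≤s (ℕ.m∸n≤m k (toℕ i))))
    where
    partial : ∀ j n → suc j ℕ.≤ n → P n j ≡ recip f j
    partial j = proj₂ (∑∞-correct (h ^_) h^n-order j)

  *-distribˡ : ∀ x y → (f * (x + y)) k ≡ (f * x) k ℤ.+ (f * y) k
  *-distribˡ x y = trans
    (sum-cong-≗ {suc k} (λ i → ℤ.*-distribˡ-+ (f (toℕ i)) (x (k ℕ.∸ toℕ i)) (y (k ℕ.∸ toℕ i))))
    (∑-distrib-+ {suc k} (λ i → f (toℕ i) ℤ.* x (k ℕ.∸ toℕ i)) (λ i → f (toℕ i) ℤ.* y (k ℕ.∸ toℕ i)))

  f+h : ∀ i → f i ℤ.+ h i ≡ 1# i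
  f+h i = begin
    f i ℤ.+ (1# i ℤ.- f i)      ≡⟨ ℤ.+-comm (f i) _ ⟩
    (1# i ℤ.- f i) ℤ.+ f i      ≡⟨ ℤ.+-assoc (1# i) (ℤ.- f i) (f i) ⟩
    1# i ℤ.+ (ℤ.- f i ℤ.+ f i)  ≡⟨ cong (λ z → 1# i ℤ.+ z) (ℤ.+-inverseˡ (f i)) ⟩
    1# i ℤ.+ 0ℤ                 ≡⟨ ℤ.+-identityʳ _ ⟩
    1# i                        ∎

  f*x+h*x : ∀ x → (f * x) k ℤ.+ (h * x) k ≡ x k
  f*x+h*x x = trans
    (sym (∑-distrib-+ {suc k} (λ i → f (toℕ i) ℤ.* x (k ℕ.∸ toℕ i)) (λ i → h (toℕ i) ℤ.* x (k ℕ.∸ toℕ i))))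
    (trans (sum-cong-≗ {suc k} (λ i → sym (ℤ.*-distribʳ-+ (x (k ℕ.∸ toℕ i)) (f (toℕ i)) (h (toℕ i)))))
           (*-agree {f + h} x k (λ i _ → f+h i)))

  cancel : ∀ {a b c} → a ℤ.+ b ≡ c → a ≡ c ℤ.- b
  cancel {a} {b} refl = sym (trans (ℤ.+-assoc a b (ℤ.- b))
    (trans (cong (λ z → a ℤ.+ z) (ℤ.+-inverseʳ b)) (ℤ.+-identityʳ a)))

  telescope : ∀ n → (f * P n) k ≡ 1# k ℤ.- (h ^ n) k
  telescope zero = trans
    (∑-zero {suc k} _ (λ i → ℤ.*-zeroʳ (f (toℕ i)))) (sym (ℤ.+-inverseʳ (1# k)))
  telescope (suc n) = begin
    (f * (P n + h ^ n)) k                                  ≡⟨ *-distribˡ (P n) (h ^ n) ⟩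
    (f * P n) k ℤ.+ (f * h ^ n) k                          ≡⟨ cong (ℤ._+ (f * h ^ n) k) (telescope n) ⟩
    1# k ℤ.- (h ^ n) k ℤ.+ (f * h ^ n) k                   ≡⟨ cancel assoc ⟩
    1# k ℤ.- (h ^ suc n) k                                 ∎
    where
    assoc : 1# k ℤ.- (h ^ n) k ℤ.+ (f * h ^ n) k ℤ.+ (h ^ suc n) k ≡ 1# k
    assoc = begin
      1# k ℤ.- (h ^ n) k ℤ.+ (f * h ^ n) k ℤ.+ (h * h ^ n) k   ≡⟨ ℤ.+-assoc (1# k ℤ.- (h ^ n) k) ((f * h ^ n) k) ((h * h ^ n) k) ⟩
      1# k ℤ.- (h ^ n) k ℤ.+ ((f * h ^ n) k ℤ.+ (h * h ^ n) k) ≡⟨ cong (λ z → 1# k ℤ.- (h ^ n) k ℤ.+ z) (f*x+h*x (h ^ n)) ⟩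
      1# k ℤ.- (h ^ n) k ℤ.+ (h ^ n) k                         ≡⟨ ℤ.+-assoc (1# k) _ _ ⟩
      1# k ℤ.+ (ℤ.- (h ^ n) k ℤ.+ (h ^ n) k)                   ≡⟨ cong (λ z → 1# k ℤ.+ z) (ℤ.+-inverseˡ ((h ^ n) k)) ⟩
      1# k ℤ.+ 0ℤ                                              ≡⟨ ℤ.+-identityʳ _ ⟩
      1# k                                                     ∎

-- Series to which recip-correct applies

*-constant : ∀ f g → f 0 ≡ 1ℤ → g 0 ≡ 1ℤ → (f * g) 0 ≡ 1ℤ
*-constant f g f₀ g₀ = cong₂ (λ x y → x ℤ.* y ℤ.+ 0ℤ) f₀ g₀

⟨⨾⟩-constant : ∀ a t → a 0 ≡ 0ℤ → ∀ n → (⟨ a ⨾ t ⟩ n) 0 ≡ 1ℤ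
⟨⨾⟩-constant a t a₀ zero    = refl
⟨⨾⟩-constant a t a₀ (suc n) =
  *-constant (1# - a * t ^ n) (⟨ a ⨾ t ⟩ n)
    (cong (λ z → 1ℤ ℤ.- (z ℤ.* (t ^ n) 0 ℤ.+ 0ℤ)) a₀) (⟨⨾⟩-constant a t a₀ n)

⟨⨾⟩∞-constant : ∀ a t → a 0 ≡ 0ℤ → ⟨ a ⨾ t ⟩∞ 0 ≡ 1ℤ
⟨⨾⟩∞-constant a t a₀ = ⟨⨾⟩-constant a t a₀ 1

{-# OPTIONS --safe #-}
module Submission where

-- Let G_i count the partitions in 𝒢 with all parts greater than 2i. Removing the
-- smallest part gives
--   G_i = (1 + q^(2i+1)) G_(i+1) + q^(2i+2) G_(i+2),
-- and this recurrence has at most one solution with prescribed limit. With γ n the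
-- n-th summand of the middle series, S_i = ∑ γ n q^(2in) is also a solution with
-- limit 1, which is the first identity. A third solution, with limit
-- (q²;q²)_∞ / (-q;q²)_∞, is the very-well-poised series
--   K_i = ∑ (-1)ⁿ q^(4n²-n+4in) (1 - q^(2i+4n)) / (1 - q^(2i+2n)) R_(n+i) / R_n
-- with R_m = (q²;q²)_m / (-q;q²)_m. Hence S_0 = (-q;q²)_∞ / (q²;q²)_∞ K_0, where
-- K_0 = ∑ (-1)ʲ q^(4j²-j) over all integers j is (q³;q⁸)_∞ (q⁵;q⁸)_∞ (q⁸;q⁸)_∞ by
-- the Jacobi triple product, obtained here as the limit of its finite form. Both
-- recurrences for explicit series are proved by telescoping.

import Defs as D
open import Algebra.Bundles using (CommutativeRing)
import Algebra.Properties.Semiring.Exp as Exp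
import Algebra.Solver.Ring
open import Algebra.Solver.Ring.AlmostCommutativeRing
  using (_-Raw-AlmostCommutative⟶_; fromCommutativeRing)
open import Data.Empty using (⊥)
open import Data.Fin.Base as Fin using (toℕ)
import Data.Fin.Properties as Fin
open import Data.Integer.Base as ℤ using (ℤ; +_; 0ℤ; 1ℤ)
import Data.Integer.Properties as ℤ
import Data.Integer.Solver as ℤSolver
open import Data.List.Base as List
  using (List; []; _∷_; _++_; _∷ʳ_; filter; length; initLast; _∷ʳ′_)
import Data.List.Properties as List
open import Data.List.Membership.Propositional using (_∈_)
open import Data.List.Membership.Propositional.Properties
  using (∈-map⁺; ∈-map⁻; ∈-++⁺ˡ; ∈-++⁺ʳ; ∈-++⁻; ∈-filter⁺; ∈-filter⁻)
open import Data.List.Membership.Propositional.Properties.WithK using (unique∧set⇒bag)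
open import Data.List.Relation.Binary.BagAndSetEquality using (∼bag⇒↭)
open import Data.List.Relation.Binary.Permutation.Propositional.Properties using (↭-length)
open import Data.List.Relation.Unary.All as All using (All; []; _∷_; all?)
import Data.List.Relation.Unary.All.Properties as All
open import Data.List.Relation.Unary.AllPairs using (AllPairs; []; _∷_)
open import Data.List.Relation.Unary.Any using (here)
import Data.List.Relation.Unary.Linked as Linked
open import Data.List.Relation.Unary.Linked.Properties using (Linked⇒AllPairs; AllPairs⇒Linked)
open import Data.List.Relation.Unary.Unique.Propositional using (Unique)
import Data.List.Relation.Unary.Unique.Propositional.Properties as Unique
open import Data.Maybe.Base as Maybe using (Maybe)
open import Data.Nat.Base as ℕ using (ℕ; zero; suc; z≤n; s≤s; ∣_-_∣)
open import Data.Nat.Divisibility using (_∣_; _∣?_; _∣0; ∣m+n∣m⇒∣n; ∣m∣n⇒∣m+n; ∣-refl)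
open import Data.Nat.ListAction using (sum)
open import Data.Nat.ListAction.Properties using (sum-++)
import Data.Nat.Properties as ℕ
import Data.Nat.Solver as ℕSolver
open import Data.Product using (_×_; _,_; proj₁; proj₂; ∃-syntax)
open import Data.Sum using (_⊎_; inj₁; inj₂)
open import Function.Bundles using (mk⇔; Equivalence)
open import Level using (0ℓ)
open import Relation.Binary.PropositionalEquality
  using (_≡_; refl; sym; trans; cong; cong₂; subst; module ≡-Reasoning)
open import Relation.Nullary using (¬_; yes; no; contradiction)
open import Relation.Nullary.Decidable using (dec⇒maybe; from-no)

open import Algebra.Properties.Semiring.Sum ℤ.+-*-semiring using (sum-cong-≗)

module Development where

  -- Ring laws for the Cauchy product of coefficient sequences.

  module Convolution where
    open ℤSolver.+-*-Solver
    open ≡-Reasoning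

    -- The sum defining `(f D.* g) (suc k)` unfolds to `f 0 ℤ.* g (suc k) ℤ.+ (tail f D.* g) k`, so
    -- the ring laws go by induction on `k` with `f` generalised.
    tail : D.Series → D.Series
    tail f k = f (suc k)

    scale : ℤ → D.Series → D.Series
    scale a f k = a ℤ.* f k

    *-cong : ∀ {f f′ g g′} → f D.≈ f′ → g D.≈ g′ → f D.* g D.≈ f′ D.* g′
    *-cong f≈ g≈ zero    = cong (ℤ._+ 0ℤ) (cong₂ ℤ._*_ (f≈ 0) (g≈ 0))
    *-cong {f} {f′} {g} {g′} f≈ g≈ (suc k) = cong₂ ℤ._+_ (cong₂ ℤ._*_ (f≈ 0) (g≈ (suc k)))
      (*-cong {tail f} {tail f′} {g} {g′} (λ i → f≈ (suc i)) g≈ k)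

    *-distribʳ : ∀ h f g → (f D.+ g) D.* h D.≈ f D.* h D.+ g D.* h
    *-distribʳ h f g zero    =
      solve 3 (λ a b c → (a :+ b) :* c :+ con 0ℤ := (a :* c :+ con 0ℤ) :+ (b :* c :+ con 0ℤ))
        refl (f 0) (g 0) (h 0)
    *-distribʳ h f g (suc k) = trans
      (cong (λ z → (f 0 ℤ.+ g 0) ℤ.* h (suc k) ℤ.+ z) (*-distribʳ h (tail f) (tail g) k))
      (solve 5 (λ a b c x y → (a :+ b) :* c :+ (x :+ y) := (a :* c :+ x) :+ (b :* c :+ y))
        refl (f 0) (g 0) (h (suc k)) ((tail f D.* h) k) ((tail g D.* h) k))

    scale-* : ∀ a f g → scale a f D.* g D.≈ scale a (f D.* g)
    scale-* a f g zero    =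
      solve 3 (λ a b c → (a :* b) :* c :+ con 0ℤ := a :* (b :* c :+ con 0ℤ)) refl a (f 0) (g 0)
    scale-* a f g (suc k) = trans
      (cong (λ z → a ℤ.* f 0 ℤ.* g (suc k) ℤ.+ z) (scale-* a (tail f) g k))
      (solve 4 (λ a b c x → a :* b :* c :+ a :* x := a :* (b :* c :+ x))
        refl a (f 0) (g (suc k)) ((tail f D.* g) k))

    *-assoc : ∀ f g h → (f D.* g) D.* h D.≈ f D.* (g D.* h)
    *-assoc f g h zero    =
      solve 3 (λ a b c → (a :* b :+ con 0ℤ) :* c :+ con 0ℤ := a :* (b :* c :+ con 0ℤ) :+ con 0ℤ)
        refl (f 0) (g 0) (h 0)
    *-assoc f g h (suc k) = begin
      -- `tail (f D.* g)` is `scale (f 0) (tail g) D.+ tail f D.* g` by computation.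
      (f D.* g) 0 ℤ.* h (suc k) ℤ.+ ((scale (f 0) (tail g) D.+ tail f D.* g) D.* h) k
        ≡⟨ cong (λ z → (f D.* g) 0 ℤ.* h (suc k) ℤ.+ z)
             (*-distribʳ h (scale (f 0) (tail g)) (tail f D.* g) k) ⟩
      (f D.* g) 0 ℤ.* h (suc k) ℤ.+ ((scale (f 0) (tail g) D.* h) k ℤ.+ ((tail f D.* g) D.* h) k)
        ≡⟨ cong₂ (λ a b → (f D.* g) 0 ℤ.* h (suc k) ℤ.+ (a ℤ.+ b))
             (scale-* (f 0) (tail g) h k) (*-assoc (tail f) g h k) ⟩
      (f D.* g) 0 ℤ.* h (suc k) ℤ.+ (f 0 ℤ.* (tail g D.* h) k ℤ.+ (tail f D.* (g D.* h)) k)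
        ≡⟨ solve 5 (λ a b c x y → (a :* b :+ con 0ℤ) :* c :+ (a :* x :+ y)
                               := a :* (b :* c :+ x) :+ y)
             refl (f 0) (g 0) (h (suc k)) ((tail g D.* h) k) ((tail f D.* (g D.* h)) k) ⟩
      f 0 ℤ.* (g D.* h) (suc k) ℤ.+ (tail f D.* (g D.* h)) k ∎

    -- The mirror image of the defining recursion: the last summand is split off instead of the
    -- first. Commutativity matches the two.
    *-tailʳ : ∀ f g k → (f D.* g) (suc k) ≡ f (suc k) ℤ.* g 0 ℤ.+ (f D.* tail g) k
    *-tailʳ f g zero    =
      solve 4 (λ a b c d → a :* b :+ (c :* d :+ con 0ℤ) := c :* d :+ (a :* b :+ con 0ℤ))
        refl (f 0) (g 1) (f 1) (g 0)
    *-tailʳ f g (suc k) = trans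
      (cong (λ z → f 0 ℤ.* g (suc (suc k)) ℤ.+ z) (*-tailʳ (tail f) g k))
      (solve 3 (λ a b c → a :+ (b :+ c) := b :+ (a :+ c)) refl
        (f 0 ℤ.* g (suc (suc k))) (f (suc (suc k)) ℤ.* g 0) ((tail f D.* tail g) k))

    *-comm : ∀ f g → f D.* g D.≈ g D.* f
    *-comm f g zero    = cong (ℤ._+ 0ℤ) (ℤ.*-comm (f 0) (g 0))
    *-comm f g (suc k) = trans
      (cong₂ ℤ._+_ (ℤ.*-comm (f 0) (g (suc k))) (*-comm (tail f) g k)) (sym (*-tailʳ g f k))

    0#* : ∀ f → D.0# D.* f D.≈ D.0#
    0#* f zero    = refl
    0#* f (suc k) = trans (cong (λ z → 0ℤ ℤ.+ z) (0#* f k)) refl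

    *-identityˡ : ∀ f → D.1# D.* f D.≈ f
    *-identityˡ f zero    = trans (ℤ.+-identityʳ _) (ℤ.*-identityˡ (f 0))
    *-identityˡ f (suc k) = trans
      (cong₂ ℤ._+_ (ℤ.*-identityˡ (f (suc k))) (0#* f k)) (ℤ.+-identityʳ _)

    *-distribˡ : ∀ h f g → h D.* (f D.+ g) D.≈ h D.* f D.+ h D.* g
    *-distribˡ h f g k = trans (*-comm h (f D.+ g) k) (trans (*-distribʳ h f g k)
      (cong₂ ℤ._+_ (*-comm f h k) (*-comm g h k)))

  suc-^2 : ∀ n → suc n ℕ.^ 2 ≡ suc ((n ℕ.+ n) ℕ.+ n ℕ.^ 2)
  suc-^2 = solve 1 (λ n → (con 1 :+ n) :^ 2 := con 1 :+ ((n :+ n) :+ n :^ 2)) refl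
    where open ℕSolver.+-*-Solver

  -- The ring of formal power series and its solver.

  open Convolution

  -- Unlike those on D.Series, the operations on this type do not unfold to sums,
  -- which keeps unification and the ring solver usable.

  record ℤ⟦q⟧ : Set where
    no-eta-equality
    field coeff : D.Series
  open ℤ⟦q⟧

  infix 4 _≋_
  record _≋_ (f g : ℤ⟦q⟧) : Set where
    constructor ⌊_⌋
    field at : coeff f D.≈ coeff g
  open _≋_

  infixl 6 _+_
  infixl 7 _*_
  infix  8 -_

  _+_ _*_ : ℤ⟦q⟧ → ℤ⟦q⟧ → ℤ⟦q⟧
  coeff (f + g) = coeff f D.+ coeff g
  coeff (f * g) = coeff f D.* coeff g

  -_ : ℤ⟦q⟧ → ℤ⟦q⟧
  coeff (- f) = D.- coeff f

  0# 1# q : ℤ⟦q⟧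
  coeff 0# = D.0#
  coeff 1# = D.1#
  coeff q  = D.q

  ring : CommutativeRing 0ℓ 0ℓ
  ring = record
    { Carrier = ℤ⟦q⟧ ; _≈_ = _≋_ ; _+_ = _+_ ; _*_ = _*_ ; -_ = -_ ; 0# = 0# ; 1# = 1#
    ; isCommutativeRing = record
      { isRing = record
        { +-isAbelianGroup = record
          { isGroup = record
            { isMonoid = record
              { isSemigroup = record
                { isMagma = record
                  { isEquivalence = record
                    { refl  = ⌊ (λ _ → refl) ⌋
                    ; sym   = λ p → ⌊ (λ k → sym (at p k)) ⌋
                    ; trans = λ p r → ⌊ (λ k → trans (at p k) (at r k)) ⌋
                    }
                  ; ∙-cong = λ p r → ⌊ (λ k → cong₂ ℤ._+_ (at p k) (at r k)) ⌋
                  }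
                ; assoc = λ f g h → ⌊ (λ k → ℤ.+-assoc (coeff f k) (coeff g k) (coeff h k)) ⌋
                }
              ; identity = (λ f → ⌊ (λ k → ℤ.+-identityˡ (coeff f k)) ⌋)
                         , (λ f → ⌊ (λ k → ℤ.+-identityʳ (coeff f k)) ⌋)
              }
            ; inverse = (λ f → ⌊ (λ k → ℤ.+-inverseˡ (coeff f k)) ⌋)
                      , (λ f → ⌊ (λ k → ℤ.+-inverseʳ (coeff f k)) ⌋)
            ; ⁻¹-cong = λ p → ⌊ (λ k → cong ℤ.-_ (at p k)) ⌋
            }
          ; comm = λ f g → ⌊ (λ k → ℤ.+-comm (coeff f k) (coeff g k)) ⌋
          }
        ; *-cong     = λ p r → ⌊ *-cong (at p) (at r) ⌋
        ; *-assoc    = λ f g h → ⌊ *-assoc (coeff f) (coeff g) (coeff h) ⌋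
        ; *-identity = (λ f → ⌊ *-identityˡ (coeff f) ⌋)
                     , (λ f → ⌊ (λ k → trans (*-comm (coeff f) D.1# k) (*-identityˡ (coeff f) k)) ⌋)
        ; distrib    = (λ h f g → ⌊ *-distribˡ (coeff h) (coeff f) (coeff g) ⌋)
                     , (λ h f g → ⌊ *-distribʳ (coeff h) (coeff f) (coeff g) ⌋)
        }
      ; *-comm = λ f g → ⌊ *-comm (coeff f) (coeff g) ⌋
      }
    }

  module R = CommutativeRing ring
  open R using (_-_)
  open Exp R.semiring using (_^_)

  congˡ : ∀ {f g g′} → g ≋ g′ → f * g ≋ f * g′
  congˡ = R.*-cong R.refl

  congʳ : ∀ {f f′ g} → f ≋ f′ → f * g ≋ f′ * g
  congʳ p = R.*-cong p R.refl

  -congʳ : ∀ {f g g′} → g ≋ g′ → f - g ≋ f - g′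
  -congʳ p = R.+-cong R.refl (R.-‿cong p)

  -- Integer scalars give the ring solver coefficients with decidable equality.
  const : ℤ → ℤ⟦q⟧
  coeff (const a) = scale a D.1#

  const-homo : ℤ.+-*-rawRing -Raw-AlmostCommutative⟶ fromCommutativeRing ring
  const-homo = record
    { ⟦_⟧    = const
    ; +-homo = λ a b → ⌊ (λ k → ℤ.*-distribʳ-+ (D.1# k) a b) ⌋
    ; *-homo = λ a b → ⌊ (λ k → begin
        a ℤ.* b ℤ.* D.1# k                 ≡⟨ ℤ.*-assoc a b (D.1# k) ⟩
        a ℤ.* (b ℤ.* D.1# k)               ≡⟨ cong (a ℤ.*_) (*-identityˡ (scale b D.1#) k) ⟨
        a ℤ.* (D.1# D.* scale b D.1#) k    ≡⟨ scale-* a D.1# (scale b D.1#) k ⟨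
        (scale a D.1# D.* scale b D.1#) k  ∎) ⌋
    ; -‿homo = λ a → ⌊ (λ k → sym (ℤ.neg-distribˡ-* a (D.1# k))) ⌋
    ; 0-homo = ⌊ (λ k → ℤ.*-zeroˡ (D.1# k)) ⌋
    ; 1-homo = ⌊ (λ k → ℤ.*-identityˡ (D.1# k)) ⌋
    }
    where open ≡-Reasoning

  const≟ : ∀ a b → Maybe (const a ≋ const b)
  const≟ a b = Maybe.map (λ { refl → R.refl }) (dec⇒maybe (a ℤ.≟ b))

  open Algebra.Solver.Ring ℤ.+-*-rawRing (fromCommutativeRing ring) const-homo const≟
    using (Polynomial; var; solve; _:=_; _:+_; _:*_; _:-_; :-_; _:^_)
  open import Relation.Binary.Reasoning.Setoid R.setoid

  -- Unlike con 1ℤ, this denotes 1# definitionally.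

  one : ∀ {n} → Polynomial (ℕ.suc n)
  one = var Fin.zero :^ 0

  infixl 7 _/_

  recip : ℤ⟦q⟧ → ℤ⟦q⟧
  coeff (recip f) = D.recip (coeff f)

  _/_ : ℤ⟦q⟧ → ℤ⟦q⟧ → ℤ⟦q⟧
  f / g = f * recip g

  ∑< : (ℕ → ℤ⟦q⟧) → ℕ → ℤ⟦q⟧
  ∑< f zero    = 0#
  ∑< f (suc n) = ∑< f n + f n

  ∑∞ : (ℕ → ℤ⟦q⟧) → ℤ⟦q⟧
  coeff (∑∞ f) = D.∑∞ (λ n → coeff (f n))

  ⟨_⨾_⟩_ : ℤ⟦q⟧ → ℤ⟦q⟧ → ℕ → ℤ⟦q⟧
  ⟨ a ⨾ t ⟩ zero  = 1#
  ⟨ a ⨾ t ⟩ suc n = (1# - a * t ^ n) * ⟨ a ⨾ t ⟩ n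

  ⟨_⨾_⟩∞ : ℤ⟦q⟧ → ℤ⟦q⟧ → ℤ⟦q⟧
  coeff ⟨ a ⨾ t ⟩∞ = D.⟨ coeff a ⨾ coeff t ⟩∞

  coeff-^ : ∀ f n → coeff (f ^ n) ≡ coeff f D.^ n
  coeff-^ f zero    = refl
  coeff-^ f (suc n) = cong (coeff f D.*_) (coeff-^ f n)

  coeff-∑< : ∀ f n → coeff (∑< f n) ≡ D.∑< (λ i → coeff (f i)) n
  coeff-∑< f zero    = refl
  coeff-∑< f (suc n) = cong (D._+ coeff (f n)) (coeff-∑< f n)

  coeff-⟨⨾⟩ : ∀ a t n → coeff (⟨ a ⨾ t ⟩ n) ≡ D.⟨ coeff a ⨾ coeff t ⟩ n
  coeff-⟨⨾⟩ a t zero    = refl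
  coeff-⟨⨾⟩ a t (suc n) = cong₂ (λ x y → (D.1# D.- coeff a D.* x) D.* y) (coeff-^ t n) (coeff-⟨⨾⟩ a t n)

  -- Congruence modulo powers of q, and infinite sums.

  infix 4 _≋_mod_
  record _≋_mod_ (f g : ℤ⟦q⟧) (N : ℕ) : Set where
    constructor ⌊_⌋
    field below : ∀ k → k ℕ.< N → coeff f k ≡ coeff g k
  open _≋_mod_

  private
    variable
      f f′ g g′ h : ℤ⟦q⟧
      M N : ℕ

  ≋⇒mod : f ≋ g → f ≋ g mod N
  ≋⇒mod p = ⌊ (λ k _ → at p k) ⌋

  mod⇒≋ : (∀ N → f ≋ g mod N) → f ≋ g
  mod⇒≋ p = ⌊ (λ k → below (p (suc k)) k ℕ.≤-refl) ⌋

  mod-refl : f ≋ f mod N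
  mod-refl = ≋⇒mod R.refl

  mod-sym : f ≋ g mod N → g ≋ f mod N
  mod-sym p = ⌊ (λ k k<N → sym (below p k k<N)) ⌋

  mod-trans : f ≋ g mod N → g ≋ h mod N → f ≋ h mod N
  mod-trans p r = ⌊ (λ k k<N → trans (below p k k<N) (below r k k<N)) ⌋

  mod-weaken : M ℕ.≤ N → f ≋ g mod N → f ≋ g mod M
  mod-weaken M≤N p = ⌊ (λ k k<M → below p k (ℕ.<-≤-trans k<M M≤N)) ⌋

  mod-+ : f ≋ f′ mod N → g ≋ g′ mod N → f + g ≋ f′ + g′ mod N
  mod-+ p r = ⌊ (λ k k<N → cong₂ ℤ._+_ (below p k k<N) (below r k k<N)) ⌋

  mod-neg : f ≋ f′ mod N → - f ≋ - f′ mod N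
  mod-neg p = ⌊ (λ k k<N → cong ℤ.-_ (below p k k<N)) ⌋

  mod-* : f ≋ f′ mod N → g ≋ g′ mod N → f * g ≋ f′ * g′ mod N
  mod-* p r = ⌊ (λ k k<N → sum-cong-≗ {suc k} λ i → cong₂ ℤ._*_
    (below p (toℕ i) (ℕ.≤-<-trans (ℕ.≤-pred (Fin.toℕ<n i)) k<N))
    (below r (k ℕ.∸ toℕ i) (ℕ.≤-<-trans (ℕ.m∸n≤m k (toℕ i)) k<N))) ⌋

  mod-*-+ : f ≋ 0# mod M → g ≋ 0# mod N → f * g ≋ 0# mod M ℕ.+ N
  mod-*-+ {f} {M} {g} {N} p r = ⌊ D.Order≥-* {M} {N} (coeff f) (coeff g) (below p) (below r) ⌋

  mod-*ˡ : ∀ g → f ≋ 0# mod N → f * g ≋ 0# mod N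
  mod-*ˡ g p = mod-trans (mod-* p mod-refl) (≋⇒mod (R.zeroˡ g))

  mod-*ʳ : ∀ f → g ≋ 0# mod N → f * g ≋ 0# mod N
  mod-*ʳ f p = mod-trans (mod-* mod-refl p) (≋⇒mod (R.zeroʳ f))

  mod-1 : ∀ f → coeff f 0 ≡ 0ℤ → f ≋ 0# mod 1
  mod-1 f f₀ = ⌊ (λ { zero _ → f₀ ; (suc _) (s≤s ()) }) ⌋

  mod-^ : ∀ f → coeff f 0 ≡ 0ℤ → ∀ n → f ^ n ≋ 0# mod n
  mod-^ f f₀ zero    = ⌊ (λ _ ()) ⌋
  mod-^ f f₀ (suc n) = mod-*-+ (mod-1 f f₀) (mod-^ f f₀ n)

  mod-+0 : g ≋ 0# mod N → f + g ≋ f mod N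
  mod-+0 {f = f} p = mod-trans (mod-+ mod-refl p) (≋⇒mod (R.+-identityʳ f))

  mod-neg0 : f ≋ 0# mod N → - f ≋ 0# mod N
  mod-neg0 p = mod-trans (mod-neg p) (≋⇒mod ⌊ (λ _ → refl) ⌋)

  ∑∞-at : ∀ f k → coeff (∑∞ f) k ≡ coeff (∑< f (suc k)) k
  ∑∞-at f k = cong (λ g → g k) (sym (coeff-∑< f (suc k)))

  ∑∞-partial : ∀ {f : ℕ → ℤ⟦q⟧} → (∀ n → f n ≋ 0# mod n) → ∑∞ f ≋ ∑< f N mod N
  ∑∞-partial {N} {f} p = ⌊ (λ k k<N → sym (trans (cong (λ g → g k) (coeff-∑< f N))
    (proj₂ (D.∑∞-correct (λ n → coeff (f n)) (λ n → below (p n)) k) N k<N))) ⌋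

  -- Each coefficient of `∑∞` is by definition that of a partial sum, and partial sums are compared
  -- termwise.
  ∑∞-cong-mod : ∀ {f g : ℕ → ℤ⟦q⟧} → (∀ n → f n ≋ g n mod N) → ∑∞ f ≋ ∑∞ g mod N
  ∑∞-cong-mod {N} {f} {g} p = ⌊ (λ k k<N →
    trans (∑∞-at f k) (trans (below (partial (suc k)) k k<N) (sym (∑∞-at g k)))) ⌋
    where
    partial : ∀ n → ∑< f n ≋ ∑< g n mod N
    partial zero    = mod-refl
    partial (suc n) = mod-+ (partial n) (p n)

  ∑∞-cong : ∀ {f g : ℕ → ℤ⟦q⟧} → (∀ n → f n ≋ g n) → ∑∞ f ≋ ∑∞ g
  ∑∞-cong p = mod⇒≋ λ N → ∑∞-cong-mod (λ n → ≋⇒mod (p n))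

  ∑∞-head : ∀ {f : ℕ → ℤ⟦q⟧} → (∀ n → f (suc n) ≋ 0# mod N) → ∑∞ f ≋ f 0 mod N
  ∑∞-head {N} {f} p = ⌊ (λ k k<N →
    trans (∑∞-at f k) (below (partial k) k k<N)) ⌋
    where
    partial : ∀ n → ∑< f (suc n) ≋ f 0 mod N
    partial zero    = ≋⇒mod (R.+-identityˡ (f 0))
    partial (suc n) = mod-trans (mod-+0 (p n)) (partial n)

  ∑∞-+ : ∀ (f g : ℕ → ℤ⟦q⟧) → ∑∞ (λ n → f n + g n) ≋ ∑∞ f + ∑∞ g
  ∑∞-+ f g = ⌊ (λ k → trans (∑∞-at (λ n → f n + g n) k) (trans (at (partial (suc k)) k)
    (sym (cong₂ ℤ._+_ (∑∞-at f k) (∑∞-at g k))))) ⌋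
    where
    partial : ∀ n → ∑< (λ n → f n + g n) n ≋ ∑< f n + ∑< g n
    partial zero    = R.sym (R.+-identityʳ 0#)
    partial (suc n) = R.trans (R.+-cong (partial n) R.refl)
      (solve 4 (λ a b c d → a :+ b :+ (c :+ d) := a :+ c :+ (b :+ d)) R.refl (∑< f n) (∑< g n) (f n) (g n))

  -- A product with `a` involves lower coefficients, which `∑∞` reads off shorter partial sums; the
  -- order condition lets one partial sum serve for all of them.
  ∑∞-* : ∀ a {f : ℕ → ℤ⟦q⟧} → (∀ n → f n ≋ 0# mod n) → ∑∞ (λ n → a * f n) ≋ a * ∑∞ f
  ∑∞-* a {f} p = mod⇒≋ λ N →
    mod-trans (∑∞-partial (λ n → mod-*ʳ a (p n)))
      (mod-trans (≋⇒mod (partial N)) (mod-* mod-refl (mod-sym (∑∞-partial p))))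
    where
    partial : ∀ n → ∑< (λ n → a * f n) n ≋ a * ∑< f n
    partial zero    = R.sym (R.zeroʳ a)
    partial (suc n) = R.trans (R.+-cong (partial n) R.refl) (R.sym (R.distribˡ a (∑< f n) (f n)))

  telescope-step : ∀ s u g u′ → s + u + (g + (u′ - u)) ≋ s + g + u′
  telescope-step = solve 4 (λ s u g u′ → s :+ u :+ (g :+ (u′ :- u)) := s :+ g :+ u′) R.refl

  -- The boundary term `U (suc k)` left by the first `suc k` summands vanishes to order `suc k`,
  -- hence does not reach coefficient `k`.
  ∑∞-telescope : ∀ {f g U : ℕ → ℤ⟦q⟧} → U 0 ≋ 0# → (∀ n → U n ≋ 0# mod n) →
    (∀ n → f n ≋ g n + (U (suc n) - U n)) → ∑∞ f ≋ ∑∞ g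
  ∑∞-telescope {f} {g} {U} U₀ Uₙ p = ⌊ (λ k → trans (∑∞-at f k) (trans (at (partial (suc k)) k)
    (trans (below (mod-+0 {f = ∑< g (suc k)} (Uₙ (suc k))) k ℕ.≤-refl) (sym (∑∞-at g k))))) ⌋
    where
    partial : ∀ n → ∑< f n ≋ ∑< g n + U n
    partial zero    = R.sym (R.trans (R.+-identityˡ (U 0)) U₀)
    partial (suc n) = R.trans (R.+-cong (partial n) (p n)) (telescope-step (∑< g n) (U n) (g n) (U (suc n)))

  -- Powers, inverses and q-shifted factorials.

  ^-+ : ∀ a m n → a ^ (m ℕ.+ n) ≋ a ^ m * a ^ n
  ^-+ a zero    n = R.sym (R.*-identityˡ (a ^ n))
  ^-+ a (suc m) n = R.trans (congˡ (^-+ a m n)) (R.sym (R.*-assoc a (a ^ m) (a ^ n)))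

  recip-inverse : ∀ f → coeff f 0 ≡ 1ℤ → f * recip f ≋ 1#
  recip-inverse f f₀ = ⌊ D.recip-correct (coeff f) f₀ ⌋

  inverse-unique : ∀ f g h → f * g ≋ 1# → f * h ≋ 1# → g ≋ h
  inverse-unique f g h p r = begin
    g            ≈⟨ R.*-identityˡ g ⟨
    1# * g       ≈⟨ congʳ r ⟨
    f * h * g    ≈⟨ congʳ (R.*-comm f h) ⟩
    h * f * g    ≈⟨ R.*-assoc h f g ⟩
    h * (f * g)  ≈⟨ congˡ p ⟩
    h * 1#       ≈⟨ R.*-identityʳ h ⟩
    h            ∎

  ⟨⨾⟩-recip : ∀ a t → coeff a 0 ≡ 0ℤ → ∀ n → ⟨ a ⨾ t ⟩ n * recip (⟨ a ⨾ t ⟩ n) ≋ 1#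
  ⟨⨾⟩-recip a t a₀ n = recip-inverse (⟨ a ⨾ t ⟩ n) (trans (cong (λ g → g 0) (coeff-⟨⨾⟩ a t n))
    (D.⟨⨾⟩-constant (coeff a) (coeff t) a₀ n))

  -- Reciprocals are rewritten upwards, from index n to n + 1, so that identities between quotients
  -- become polynomial in the reciprocal of largest index.
  recip-⟨⨾⟩-suc : ∀ a t → coeff a 0 ≡ 0ℤ → ∀ n →
    recip (⟨ a ⨾ t ⟩ n) ≋ (1# - a * t ^ n) * recip (⟨ a ⨾ t ⟩ (suc n))
  recip-⟨⨾⟩-suc a t a₀ n = inverse-unique P (recip P) (F * recip (F * P)) (⟨⨾⟩-recip a t a₀ n)
    (R.trans (R.sym (R.*-assoc P F (recip (F * P))))
      (R.trans (congʳ (R.*-comm P F)) (⟨⨾⟩-recip a t a₀ (suc n))))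
    where
    P F : ℤ⟦q⟧
    P = ⟨ a ⨾ t ⟩ n
    F = 1# - a * t ^ n

  ⟨⨾⟩-mod : ∀ a {t} → coeff t 0 ≡ 0ℤ → N ℕ.≤ M → ⟨ a ⨾ t ⟩ M ≋ ⟨ a ⨾ t ⟩∞ mod N
  ⟨⨾⟩-mod {M = M} a {t} t₀ N≤M = ⌊ (λ k k<N →
    trans (cong (λ g → g k) (coeff-⟨⨾⟩ a t M))
      (proj₂ (D.⟨⨾⟩∞-correct (coeff a) (coeff t) t₀ k) M (ℕ.<-≤-trans k<N N≤M))) ⌋

  -- The recurrence and the uniqueness of its solutions.

  Recurrence : (ℕ → ℤ⟦q⟧) → Set
  Recurrence G = ∀ i → G i ≋
    (1# + q * (q ^ 2) ^ i) * G (suc i) + q ^ 2 * (q ^ 2) ^ i * G (suc (suc i))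

  recurrence-perturbation : ∀ q x f g → (1# + q * x) * f + q ^ 2 * x * g ≋ f + q * (x * f + q * x * g)
  recurrence-perturbation = solve 4 (λ q x f g →
    (one :+ q :* x) :* f :+ q :^ 2 :* x :* g := f :+ q :* (x :* f :+ q :* x :* g)) R.refl

  -- Induction on the modulus. If every `D i` vanishes modulo q^N, the recurrence gives
  -- `D i ≋ D (suc i)` modulo q^(N+1), since the remaining terms carry a factor q. Moving up to
  -- index `suc N + i`, where the limit hypothesis applies, gains one order.
  recurrence-vanish : ∀ {D} → Recurrence D → (∀ i → D i ≋ 0# mod i) → ∀ i → D i ≋ 0#
  recurrence-vanish {D} rec D→0 i = mod⇒≋ λ N → vanish N i
    where
    vanish : ∀ N i → D i ≋ 0# mod N
    vanish zero    i = ⌊ (λ _ ()) ⌋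
    vanish (suc N) i = mod-trans (go (suc N)) (mod-weaken (ℕ.m≤m+n (suc N) i) (D→0 (suc N ℕ.+ i)))
      where
      x : ℕ → ℤ⟦q⟧
      x i = (q ^ 2) ^ i
      shift : ∀ i → D i ≋ D (suc i) mod suc N
      shift i = mod-trans
        (≋⇒mod (R.trans (rec i) (recurrence-perturbation q (x i) (D (suc i)) (D (suc (suc i))))))
        (mod-+0 (mod-*-+ (mod-1 q refl) (mod-trans
          (mod-+ (mod-*ʳ (x i) (vanish N (suc i))) (mod-*ʳ (q * x i) (vanish N (suc (suc i)))))
          (≋⇒mod (R.+-identityʳ 0#)))))
      go : ∀ d → D i ≋ D (d ℕ.+ i) mod suc N
      go zero    = mod-refl
      go (suc d) = mod-trans (go d) (shift (d ℕ.+ i))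

  recurrence-unique : ∀ {F G} → Recurrence F → Recurrence G → (∀ i → F i ≋ G i mod i) → ∀ i → F i ≋ G i
  recurrence-unique {F} {G} recF recG F~G i = begin
    F i              ≈⟨ solve 2 (λ f g → f := (f :- g) :+ g) R.refl (F i) (G i) ⟩
    F i - G i + G i  ≈⟨ R.+-cong (recurrence-vanish {λ i → F i - G i} rec lim i) R.refl ⟩
    0# + G i         ≈⟨ R.+-identityˡ (G i) ⟩
    G i              ∎
    where
    rec : Recurrence (λ i → F i - G i)
    rec i = R.trans (R.+-cong (recF i) (R.-‿cong (recG i)))
      (solve 6 (λ a b f g f′ g′ → a :* f :+ b :* g
          :- (a :* f′ :+ b :* g′) := a :* (f :- f′) :+ b :* (g :- g′))
        R.refl (1# + q * (q ^ 2) ^ i) (q ^ 2 * (q ^ 2) ^ i)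
        (F (suc i)) (F (suc (suc i))) (G (suc i)) (G (suc (suc i))))
    lim : ∀ i → F i - G i ≋ 0# mod i
    lim i = mod-trans (mod-+ (F~G i) mod-refl) (≋⇒mod (R.-‿inverseʳ (G i)))

  recurrence-scale : ∀ {G} a → Recurrence G → Recurrence (λ i → a * G i)
  recurrence-scale {G} a rec i = R.trans (congˡ (rec i))
    (solve 5 (λ u a b f g → u :* (a :* f :+ b :* g) := a :* (u :* f) :+ b :* (u :* g)) R.refl
      a (1# + q * (q ^ 2) ^ i) (q ^ 2 * (q ^ 2) ^ i) (G (suc i)) (G (suc (suc i))))

  1^ : ∀ n → 1# ^ n ≋ 1#
  1^ zero    = R.refl
  1^ (suc n) = R.trans (R.*-identityˡ (1# ^ n)) (1^ n)

  product-interchange : ∀ a b c d → a * b * (c * d) ≋ a * c * (b * d)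
  product-interchange = solve 4 (λ a b c d → a :* b :* (c :* d) := a :* c :* (b :* d)) R.refl

  ^-distrib-* : ∀ a b n → (a * b) ^ n ≋ a ^ n * b ^ n
  ^-distrib-* a b zero    = R.sym (R.*-identityˡ 1#)
  ^-distrib-* a b (suc n) = R.trans (congˡ (^-distrib-* a b n))
    (product-interchange a b (a ^ n) (b ^ n))

  -- Creative telescoping: the summands satisfy the recurrence up to differences of the certificate
  -- `U`, and these sum to zero.
  recurrence-∑∞ : ∀ (t U : ℕ → ℕ → ℤ⟦q⟧) →
    (∀ i n → t i n ≋ 0# mod n) → (∀ i → U i 0 ≋ 0#) → (∀ i n → U i n ≋ 0# mod n) →
    (∀ i n → t i n ≋ (1# + q * (q ^ 2) ^ i) * t (suc i) n + q ^ 2 * (q ^ 2) ^ i * t (suc (suc i)) n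
      + (U i (suc n) - U i n)) →
    Recurrence (λ i → ∑∞ (t i))
  recurrence-∑∞ t U tₙ U₀ Uₙ step i = begin
    ∑∞ (t i)
      ≈⟨ ∑∞-telescope (U₀ i) (Uₙ i) (step i) ⟩
    ∑∞ (λ n → a * t (suc i) n + b * t (suc (suc i)) n)
      ≈⟨ ∑∞-+ (λ n → a * t (suc i) n) (λ n → b * t (suc (suc i)) n) ⟩
    ∑∞ (λ n → a * t (suc i) n) + ∑∞ (λ n → b * t (suc (suc i)) n)
      ≈⟨ R.+-cong (∑∞-* a (tₙ (suc i))) (∑∞-* b (tₙ (suc (suc i)))) ⟩
    a * ∑∞ (t (suc i)) + b * ∑∞ (t (suc (suc i))) ∎
    where
    a b : ℤ⟦q⟧
    a = 1# + q * (q ^ 2) ^ i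
    b = q ^ 2 * (q ^ 2) ^ i

  -- The middle series as a solution.

  y : ℕ → ℤ⟦q⟧
  y n = (q ^ 2) ^ n

  y-mod : ∀ n → y n ≋ 0# mod n
  y-mod = mod-^ (q ^ 2) refl

  square-step : ∀ q a → q * (q * a) ≋ q ^ 2 * a
  square-step = solve 2 (λ q a → q :* (q :* a) := q :^ 2 :* a) R.refl

  q^2n : ∀ n → q ^ (n ℕ.+ n) ≋ y n
  q^2n zero    = R.refl
  q^2n (suc n) rewrite ℕ.+-suc n n =
    R.trans (square-step q (q ^ (n ℕ.+ n))) (congˡ (q^2n n))

  -- The quotient R_m is `p m * r m`.
  p o s r : ℕ → ℤ⟦q⟧
  p n = ⟨ q ^ 2 ⨾ q ^ 2 ⟩ n
  o n = ⟨ - q ⨾ q ^ 2 ⟩ n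
  s n = recip (p n)
  r n = recip (o n)

  p∞ o∞ : ℤ⟦q⟧
  p∞ = ⟨ q ^ 2 ⨾ q ^ 2 ⟩∞
  o∞ = ⟨ - q ⨾ q ^ 2 ⟩∞

  p*s : ∀ n → p n * s n ≋ 1#
  p*s = ⟨⨾⟩-recip (q ^ 2) (q ^ 2) refl

  o*r : ∀ n → o n * r n ≋ 1#
  o*r = ⟨⨾⟩-recip (- q) (q ^ 2) refl

  s-suc : ∀ n → s n ≋ (1# - q ^ 2 * y n) * s (suc n)
  s-suc = recip-⟨⨾⟩-suc (q ^ 2) (q ^ 2) refl

  r-suc : ∀ n → r n ≋ (1# - - q * y n) * r (suc n)
  r-suc = recip-⟨⨾⟩-suc (- q) (q ^ 2) refl

  s-zero : s 0 ≋ 1#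
  s-zero = R.trans (R.sym (R.*-identityˡ (s 0))) (p*s 0)

  γ : ℕ → ℤ⟦q⟧
  γ n = o n * q ^ (n ℕ.^ 2) / p n

  γ-mod : ∀ n → γ n ≋ 0# mod n
  γ-mod n = mod-*ˡ (s n) (mod-*ʳ (o n) (mod-weaken (n≤n² n) (mod-^ q refl (n ℕ.^ 2))))
    where
    n≤n² : ∀ n → n ℕ.≤ n ℕ.^ 2
    n≤n² zero    = z≤n
    n≤n² (suc n) = ℕ.m≤m*n (suc n) (suc n ℕ.^ 1)

  gordon-ratio : ∀ z q y O Q S →
    (1# - z) * ((1# - - q * y) * O * (q * (y * Q)) * S) ≋ q * y * (1# + q * y) * (O * Q * ((1# - z) * S))
  gordon-ratio = solve 6 (λ z q y O Q S →
    (one :- z) :* ((one :- :- q :* y) :* O :* (q :* (y :* Q)) :* S)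
    := q :* y :* (one :+ q :* y) :* (O :* Q :* ((one :- z) :* S))) R.refl

  -- The ratio of consecutive summands, cleared of denominators; `q * y n` is q to the power (n+1)²
  -- - n².
  γ-suc : ∀ n → (1# - q ^ 2 * y n) * γ (suc n) ≋ q * y n * (1# + q * y n) * γ n
  γ-suc n = begin
    F * (o (suc n) * q ^ (suc n ℕ.^ 2) * s (suc n))
      ≈⟨ congˡ (congʳ (congˡ square)) ⟩
    F * (o (suc n) * (q * (y n * q ^ (n ℕ.^ 2))) * s (suc n))
      ≈⟨ gordon-ratio (q ^ 2 * y n) q (y n) (o n) (q ^ (n ℕ.^ 2)) (s (suc n)) ⟩
    c * (o n * q ^ (n ℕ.^ 2) * (F * s (suc n)))
      ≈⟨ congˡ (congˡ (s-suc n)) ⟨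
    c * γ n ∎
    where
    F c : ℤ⟦q⟧
    F = 1# - q ^ 2 * y n
    c = q * y n * (1# + q * y n)
    square : q ^ (suc n ℕ.^ 2) ≋ q * (y n * q ^ (n ℕ.^ 2))
    square = R.trans (R.reflexive (cong (λ m → q ^ m) (suc-^2 n))) (congˡ
      (R.trans (^-+ q (n ℕ.+ n) (n ℕ.^ 2)) (congʳ (q^2n n))))

  S : ℕ → ℤ⟦q⟧
  S i = ∑∞ (λ n → γ n * y n ^ i)

  gordon-step : ∀ g Y q x y →
    g * Y ≋ (1# + q * x) * (g * (y * Y)) + q ^ 2 * x * (g * (y * (y * Y)))
      + (- (q * y * (1# + q * y) * g * (x * Y)) - - ((1# - y) * g * Y))
  gordon-step = solve 5 (λ g Y q x y →
    g :* Y := (one :+ q :* x) :* (g :* (y :* Y)) :+ q :^ 2 :* x :* (g :* (y :* (y :* Y)))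
      :+ (:- (q :* y :* (one :+ q :* y) :* g :* (x :* Y)) :- :- ((one :- y) :* g :* Y))) R.refl

  S-recurrence : Recurrence S
  S-recurrence = recurrence-∑∞ (λ i n → γ n * y n ^ i) U
    (λ i n → mod-*ˡ (y n ^ i) (γ-mod n))
    vanish
    (λ i n → mod-neg0 (mod-*ˡ (y n ^ i) (mod-*ʳ (1# - y n) (γ-mod n))))
    step
    where
    U : ℕ → ℕ → ℤ⟦q⟧
    -- With x = q^(2i) and y = q^(2n), the defect of the recurrence is `γ n * y n ^ i` times (1 - y)
    -- - qxy(1 + qy). By `γ-suc` the second part is the first part at n + 1.
    U i n = - ((1# - y n) * γ n * y n ^ i)
    vanish : ∀ i → U i 0 ≋ 0#
    vanish i = R.trans (R.-‿cong (R.trans (congʳ (R.trans (congʳ (R.-‿inverseʳ 1#)) (R.zeroˡ (γ 0))))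
      (R.zeroˡ (y 0 ^ i)))) ⌊ (λ _ → refl) ⌋
    U-suc : ∀ i n → U i (suc n) ≋ - (q * y n * (1# + q * y n) * γ n * (y i * y n ^ i))
    U-suc i n = R.-‿cong (R.*-cong (γ-suc n) (^-distrib-* (q ^ 2) (y n) i))
    step : ∀ i n → γ n * y n ^ i ≋ (1# + q * y i) * (γ n * y n ^ suc i)
      + q ^ 2 * y i * (γ n * y n ^ suc (suc i)) + (U i (suc n) - U i n)
    step i n = R.trans (gordon-step (γ n) (y n ^ i) q (y i) (y n))
      (R.+-cong R.refl (R.+-cong (R.sym (U-suc i n)) R.refl))

  S-limit : ∀ i → S i ≋ 1# mod i
  S-limit i = mod-trans
    (∑∞-head (λ n → mod-*ʳ (γ (suc n)) (mod-^ (y (suc n)) refl i)))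
    (≋⇒mod (begin
      1# * 1# * s 0 * 1# ^ i  ≈⟨ R.*-cong (R.*-cong (R.*-identityˡ 1#) s-zero) (1^ i) ⟩
      1# * 1# * 1#            ≈⟨ congʳ (R.*-identityˡ 1#) ⟩
      1# * 1#                 ≈⟨ R.*-identityˡ 1# ⟩
      1#                      ∎))

  -- The very-well-poised series as a solution.

  -- e i n = (-1)ⁿ q^(4n² + n + 4in)

  e : ℕ → ℕ → ℤ⟦q⟧
  e i zero    = 1#
  e i (suc n) = - (q ^ 5 * y n ^ 4 * y i ^ 2) * e i n

  e-mod : ∀ i n → e i n ≋ 0# mod n
  e-mod i zero    = ⌊ (λ _ ()) ⌋
  e-mod i (suc n) = mod-*-+ (mod-1 (- (q ^ 5 * y n ^ 4 * y i ^ 2)) refl) (e-mod i n)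

  e-suc-mod : ∀ i n → e i (suc n) ≋ 0# mod i
  e-suc-mod i n = mod-*ˡ (e i n) (mod-neg0 (mod-*ʳ (q ^ 5 * y n ^ 4) (mod-*ˡ (y i * 1#) (y-mod i))))

  e-shift : ∀ e q x y →
    - (q ^ 5 * y ^ 4 * (q ^ 2 * x) ^ 2) * (e * y ^ 2) ≋ - (q ^ 5 * y ^ 4 * x ^ 2) * e * (q ^ 2 * y) ^ 2
  e-shift = solve 4 (λ e q x y →
    :- (q :^ 5 :* y :^ 4 :* (q :^ 2 :* x) :^ 2) :* (e :* y :^ 2)
    := :- (q :^ 5 :* y :^ 4 :* x :^ 2) :* e :* (q :^ 2 :* y) :^ 2) R.refl

  e-suc : ∀ i n → e (suc i) n ≋ e i n * y n ^ 2
  e-suc i zero    = R.sym (R.trans (R.*-identityˡ (1# ^ 2)) (1^ 2))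
  e-suc i (suc n) = R.trans (congˡ (e-suc i n)) (e-shift (e i n) q (y i) (y n))

  ^2-^2 : ∀ e y → e * y ^ 2 * y ^ 2 ≋ e * y ^ 4
  ^2-^2 = solve 2 (λ e y → e :* y :^ 2 :* y :^ 2 := e :* y :^ 4) R.refl

  e-suc² : ∀ i n → e (suc (suc i)) n ≋ e i n * y n ^ 4
  e-suc² i n = R.trans (e-suc (suc i) n) (R.trans (congʳ (e-suc i n)) (^2-^2 (e i n) (y n)))

  -- With x = q²ⁱ and y = q²ⁿ, E comes from the very-well-poised factor 1 - x y²,
  -- split as (1 - y) + y (1 - x y); shifting the index in the first half clears the
  -- denominator. W was found by solving well-poised for it in powers of y.

  E W : (q x y : ℤ⟦q⟧) → ℤ⟦q⟧
  E q x y = 1# + q * x * y - q ^ 3 * x ^ 2 * y ^ 3 * (1# + q * y)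
  W q x y = q ^ 4 * x ^ 2 * y ^ 4
    - (1# + y + q * x * y + q ^ 3 * x * y + q ^ 3 * x * y ^ 2 + q ^ 4 * x ^ 2 * y ^ 2 + q ^ 2 * x * y ^ 3)

  -- The index shift leaves a denominator 1 + qxy, which raises the index of `r` to `suc (i + n)`;
  -- `E` is the combined numerator of the two halves.
  t : ℕ → ℕ → ℤ⟦q⟧
  t i n = e i n * p (i ℕ.+ n) * s n * o n * r (suc (i ℕ.+ n)) * E q (y i) (y n)

  :E :W : ∀ {n} (q x y : Polynomial (ℕ.suc n)) → Polynomial (ℕ.suc n)
  :E q x y = one :+ q :* x :* y :- q :^ 3 :* x :^ 2 :* y :^ 3 :* (one :+ q :* y)
  :W q x y = q :^ 4 :* x :^ 2 :* y :^ 4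
    :- (one :+ y :+ q :* x :* y :+ q :^ 3 :* x :* y :+ q :^ 3 :* x :* y :^ 2
      :+ q :^ 4 :* x :^ 2 :* y :^ 2 :+ q :^ 2 :* x :* y :^ 3)

  -- The telescoping identity for `t` with all quotients expressed through `P = p (i + n)`,
  -- `S = s (suc n)`, `O = o n` and `ρ = r (3 + i + n)`, so that a polynomial identity remains.
  well-poised : ∀ e P S O ρ q x y →
    e * P * ((1# - q ^ 2 * y) * S) * O * ((1# + q ^ 3 * (x * y)) * ((1# + q ^ 5 * (x * y)) * ρ)) * E q x y
    ≋ (1# + q * x) * (e * y ^ 2 * ((1# - q ^ 2 * (x * y)) * P) * ((1# - q ^ 2 * y) * S) * O
        * ((1# + q ^ 5 * (x * y)) * ρ) * E q (q ^ 2 * x) y)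
    + q ^ 2 * x * (e * y ^ 4 * ((1# - q ^ 4 * (x * y)) * ((1# - q ^ 2 * (x * y)) * P)) * ((1# - q ^ 2 * y) * S)
        * O * ρ * E q (q ^ 2 * (q ^ 2 * x)) y)
    + ((1# - q ^ 2 * y) * W q x (q ^ 2 * y) * (- (q ^ 5 * y ^ 4 * x ^ 2) * e * ((1# - q ^ 2 * (x * y)) * P)
        * S * ((1# + q * y) * O) * ρ)
      - (1# - y) * W q x y * (e * P * ((1# - q ^ 2 * y) * S) * O * ((1# + q ^ 5 * (x * y)) * ρ)))
  well-poised = solve 8 (λ e P S O ρ q x y →
    let f₃ = one :+ q :^ 3 :* (x :* y)
        f₅ = one :+ q :^ 5 :* (x :* y)
        g₂ = one :- q :^ 2 :* (x :* y)
        g₄ = one :- q :^ 4 :* (x :* y)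
        g  = one :- q :^ 2 :* y
    in
    e :* P :* (g :* S) :* O :* (f₃ :* (f₅ :* ρ)) :* :E q x y
    := (one :+ q :* x) :* (e :* y :^ 2 :* (g₂ :* P) :* (g :* S) :* O :* (f₅ :* ρ) :* :E q (q :^ 2 :* x) y)
    :+ q :^ 2 :* x :* (e :* y :^ 4 :* (g₄ :* (g₂ :* P)) :* (g :* S) :* O :* ρ
        :* :E q (q :^ 2 :* (q :^ 2 :* x)) y)
    :+ (g :* :W q x (q :^ 2 :* y) :* (:- (q :^ 5 :* y :^ 4 :* x :^ 2) :* e :* (g₂ :* P)
        :* S :* ((one :+ q :* y) :* O) :* ρ)
      :- (one :- y) :* :W q x y :* (e :* P :* (g :* S) :* O :* (f₅ :* ρ)))) R.refl

  product-cong : ∀ {a b c d x a′ b′ c′ d′ x′} → a ≋ a′ → b ≋ b′ → c ≋ c′ → d ≋ d′ → x ≋ x′ →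
    a * b * c * d * x ≋ a′ * b′ * c′ * d′ * x′
  product-cong a b c d x = R.*-cong (R.*-cong (R.*-cong (R.*-cong a b) c) d) x

  1+qz : ∀ q z → 1# - - q * z ≋ 1# + q * z
  1+qz = solve 2 (λ q z → one :- :- q :* z := one :+ q :* z) R.refl

  1+q³z : ∀ q z → 1# - - q * (q ^ 2 * z) ≋ 1# + q ^ 3 * z
  1+q³z = solve 2 (λ q z → one :- :- q :* (q :^ 2 :* z) := one :+ q :^ 3 :* z) R.refl

  1+q⁵z : ∀ q z → 1# - - q * (q ^ 2 * (q ^ 2 * z)) ≋ 1# + q ^ 5 * z
  1+q⁵z = solve 2 (λ q z → one :- :- q :* (q :^ 2 :* (q :^ 2 :* z)) := one :+ q :^ 5 :* z) R.refl

  1-q⁴z : ∀ q z → 1# - q ^ 2 * (q ^ 2 * z) ≋ 1# - q ^ 4 * z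
  1-q⁴z = solve 2 (λ q z → one :- q :^ 2 :* (q :^ 2 :* z) := one :- q :^ 4 :* z) R.refl

  t-recurrence : Recurrence (λ i → ∑∞ (t i))
  t-recurrence = recurrence-∑∞ t U
    (λ i n → mod-*ˡ (E q (y i) (y n)) (order i n (r (suc (i ℕ.+ n)))))
    (λ i → R.trans (congʳ (R.trans (congʳ (R.-‿inverseʳ 1#)) (R.zeroˡ (W q (y i) 1#)))) (R.zeroˡ _))
    (λ i n → mod-*ʳ ((1# - y n) * W q (y i) (y n)) (order i n (r (suc (suc (i ℕ.+ n))))))
    step
    where
    U : ℕ → ℕ → ℤ⟦q⟧
    -- The factor `1# - y n` makes `U i 0` vanish.
    U i n = (1# - y n) * W q (y i) (y n) * (e i n * p (i ℕ.+ n) * s n * o n * r (suc (suc (i ℕ.+ n))))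
    order : ∀ i n z → e i n * p (i ℕ.+ n) * s n * o n * z ≋ 0# mod n
    order i n z = mod-*ˡ z (mod-*ˡ (o n) (mod-*ˡ (s n) (mod-*ˡ (p (i ℕ.+ n)) (e-mod i n))))
    step : ∀ i n → t i n ≋ (1# + q * y i) * t (suc i) n + q ^ 2 * y i * t (suc (suc i)) n
      + (U i (suc n) - U i n)
    step i n = R.trans t₀ (R.trans (well-poised (e i n) P (s (suc n)) (o n) ρ q x v)
      (R.sym (R.+-cong (R.+-cong (congˡ t₁) (congˡ t₂)) (R.+-cong U₁ (R.-‿cong U₀)))))
      where
      x v P ρ : ℤ⟦q⟧
      x = y i
      v = y n
      P = p (i ℕ.+ n)
      ρ = r (suc (suc (suc (i ℕ.+ n))))
      yy : y (i ℕ.+ n) ≋ x * v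
      yy = ^-+ (q ^ 2) i n
      p₁ : p (suc (i ℕ.+ n)) ≋ (1# - (q ^ 2 * (x * v))) * P
      p₁ = congʳ (-congʳ (congˡ yy))
      p₂ : p (suc (suc (i ℕ.+ n))) ≋ (1# - (q ^ 4 * (x * v))) * ((1# - (q ^ 2 * (x * v))) * P)
      p₂ = R.*-cong (R.trans (1-q⁴z q (y (i ℕ.+ n))) (-congʳ (congˡ yy))) p₁
      r₂ : r (suc (suc (i ℕ.+ n))) ≋ (1# + q ^ 5 * (x * v)) * ρ
      r₂ = R.trans (r-suc (suc (suc (i ℕ.+ n)))) (congʳ
        (R.trans (1+q⁵z q (y (i ℕ.+ n))) (R.+-cong R.refl (congˡ yy))))
      r₁ : r (suc (i ℕ.+ n)) ≋ (1# + q ^ 3 * (x * v)) * ((1# + q ^ 5 * (x * v)) * ρ)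
      r₁ = R.trans (r-suc (suc (i ℕ.+ n))) (R.*-cong
        (R.trans (1+q³z q (y (i ℕ.+ n))) (R.+-cong R.refl (congˡ yy))) r₂)
      s₀ : s n ≋ (1# - (q ^ 2 * v)) * s (suc n)
      s₀ = s-suc n
      o₁ : o (suc n) ≋ (1# + q * v) * o n
      o₁ = congʳ (1+qz q v)
      +suc : ∀ (f : ℕ → ℤ⟦q⟧) → f (i ℕ.+ suc n) ≋ f (suc (i ℕ.+ n))
      +suc f = R.reflexive (cong f (ℕ.+-suc i n))
      t₀ = congʳ (product-cong R.refl R.refl s₀ R.refl r₁)
      t₁ = congʳ (product-cong (e-suc i n) p₁ s₀ R.refl r₂)
      t₂ = congʳ (product-cong (e-suc² i n) p₂ s₀ R.refl R.refl)
      U₁ = congˡ (product-cong R.refl (R.trans (+suc p) p₁) R.refl o₁ (+suc (λ m → r (suc (suc m)))))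
      U₀ = congˡ (product-cong R.refl R.refl s₀ R.refl r₂)

  K : ℕ → ℤ⟦q⟧
  K i = ∑∞ (t i)

  E-mod : ∀ {x} v → x ≋ 0# mod N → E q x v ≋ 1# mod N
  E-mod {x = x} v p = mod-trans
    (mod-+0 (mod-neg0 (mod-*ˡ (1# + q * v) (mod-*ˡ (v ^ 3) (mod-*ʳ (q ^ 3) (mod-*ˡ (x * 1#) p))))))
    (mod-+0 (mod-*ˡ v (mod-*ʳ q p)))

  K-head : ∀ o p r → o * (1# * p * 1# * 1# * r * 1#) ≋ p * (o * r)
  K-head = solve 3 (λ o p r → o :* (one :* p :* one :* one :* r :* one) := p :* (o :* r)) R.refl

  -- Modulo q^i only the summand n = 0 survives, and it tends to (q²;q²)_∞ / (-q;q²)_∞.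
  -- Multiplication by `o∞` keeps the limit free of quotients: modulo q^i it is `o (suc i)`, which
  -- cancels `r (suc i)`.
  K-limit : ∀ i → o∞ * K i ≋ p∞ mod i
  K-limit i =
    mod-trans (mod-* mod-refl (∑∞-head λ n →
      mod-*ˡ (E q (y i) (y (suc n))) (mod-*ˡ _ (mod-*ˡ _ (mod-*ˡ _ (mod-*ˡ _ (e-suc-mod i n)))))))
    (mod-trans (mod-* (mod-sym (⟨⨾⟩-mod (- q) refl (ℕ.n≤1+n i)))
      (mod-* (mod-* (mod-* (mod-* (mod-* mod-refl p-limit) (≋⇒mod s-zero)) mod-refl) (≋⇒mod r-index))
        (E-mod (y 0) (y-mod i))))
    (≋⇒mod (R.trans (K-head (o (suc i)) p∞ (r (suc i))) (R.trans (congˡ (o*r (suc i))) (R.*-identityʳ p∞)))))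
    where
    p-limit : p (i ℕ.+ 0) ≋ p∞ mod i
    p-limit = ⟨⨾⟩-mod (q ^ 2) refl (ℕ.m≤m+n i 0)
    r-index : r (suc (i ℕ.+ 0)) ≋ r (suc i)
    r-index = R.reflexive (cong (λ m → r (suc m)) (ℕ.+-identityʳ i))

  -- With a general index in place of 0, both sides solve the recurrence with limit `p∞`.
  o∞*K≋p∞*S : o∞ * K 0 ≋ p∞ * S 0
  o∞*K≋p∞*S = recurrence-unique (recurrence-scale o∞ t-recurrence) (recurrence-scale p∞ S-recurrence)
    (λ i → mod-trans (K-limit i) (mod-sym
      (mod-trans (mod-* mod-refl (S-limit i)) (≋⇒mod (R.*-identityʳ p∞))))) 0

  -- At x = 1, `E` factors as (1 + qy)(1 - q³y³), and the first factor turns `r (suc n)` back into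
  -- `r n`, the inverse of `o n`.
  K₀-term : ∀ q e p s o r y →
    e * p * s * o * r * E q 1# y ≋ p * s * (o * ((1# - - q * y) * r)) * (e * (1# - q ^ 3 * y ^ 3))
  K₀-term = solve 7 (λ q e p s o r y →
    e :* p :* s :* o :* r :* :E q one y
    := p :* s :* (o :* ((one :- :- q :* y) :* r)) :* (e :* (one :- q :^ 3 :* y :^ 3))) R.refl

  -- In the bilateral sum of (-1)^j q^(4j² - j), `e 0 n` is the term j = -n, and `e 0 n` times
  -- -q^(6n+3) is the term j = n + 1.
  K₀ : K 0 ≋ ∑∞ (λ n → e 0 n * (1# - q ^ 3 * y n ^ 3))
  K₀ = ∑∞-cong λ n → R.trans (K₀-term q (e 0 n) (p n) (s n) (o n) (r (suc n)) (y n))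
    (R.trans (congʳ (R.trans (R.*-cong (p*s n) (R.trans (congˡ (R.sym (r-suc n))) (o*r n))) (R.*-identityʳ 1#)))
      (R.*-identityˡ _))

  -- The Jacobi triple product in base q⁸, from its finite form.

  Q : ℤ⟦q⟧
  Q = q ^ 8

  w P P⁻¹ : ℕ → ℤ⟦q⟧
  w N = Q ^ N
  P m = ⟨ Q ⨾ Q ⟩ m
  P⁻¹ m = recip (P m)

  P*P⁻¹ : ∀ m → P m * P⁻¹ m ≋ 1#
  P*P⁻¹ = ⟨⨾⟩-recip Q Q refl

  P⁻¹-suc : ∀ m → P⁻¹ m ≋ (1# - Q * w m) * P⁻¹ (suc m)
  P⁻¹-suc = recip-⟨⨾⟩-suc Q Q refl

  w-mod : ∀ N → w N ≋ 0# mod N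
  w-mod = mod-^ Q refl

  y⁴-step : ∀ q y → q ^ 8 * y ^ 4 ≋ (q ^ 2 * y) ^ 4
  y⁴-step = solve 2 (λ q y → q :^ 8 :* y :^ 4 := (q :^ 2 :* y) :^ 4) R.refl

  Q^n : ∀ n → w n ≋ y n ^ 4
  Q^n zero    = R.sym (1^ 4)
  Q^n (suc n) = R.trans (congˡ (Q^n n)) (y⁴-step q (y n))

  w-+ : ∀ n N → w (n ℕ.+ N) ≋ y n ^ 4 * w N
  w-+ n N = R.trans (^-+ Q n N) (congʳ (Q^n n))

  -- φ N n = (-1)ⁿ q^(4n² + n) (1 - Q^N) ⋯ (1 - Q^(N-n+1)), where a factor Q^k of
  -- q^(4n² + n) is absorbed into each 1 - Q^(N-k) to avoid the subtraction.

  φ : ℕ → ℕ → ℤ⟦q⟧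
  φ N zero    = 1#
  φ N (suc n) = - (q ^ 5 * (y n ^ 4 - w N)) * φ N n

  φ-base : ∀ q z → - (q ^ 5 * (1# ^ 4 - z)) * 1# ≋ - (q ^ 5 * 1# ^ 4 * (1# - z)) * 1#
  φ-base = solve 2 (λ q z →
    :- (q :^ 5 :* (one :^ 4 :- z)) :* one := :- (q :^ 5 :* one :^ 4 :* (one :- z)) :* one) R.refl

  φ-step : ∀ q y w φ →
    - (q ^ 5 * ((q ^ 2 * y) ^ 4 - q ^ 8 * w)) * (- (q ^ 5 * y ^ 4 * (1# - q ^ 8 * w)) * φ)
    ≋ - (q ^ 5 * (q ^ 2 * y) ^ 4 * (1# - q ^ 8 * w)) * (- (q ^ 5 * (y ^ 4 - w)) * φ)
  φ-step = solve 4 (λ q y w φ →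
    :- (q :^ 5 :* ((q :^ 2 :* y) :^ 4 :- q :^ 8 :* w)) :* (:- (q :^ 5 :* y :^ 4 :* (one :- q :^ 8 :* w)) :* φ)
    := :- (q :^ 5 :* (q :^ 2 :* y) :^ 4 :* (one :- q :^ 8 :* w))
      :* (:- (q :^ 5 :* (y :^ 4 :- w)) :* φ)) R.refl

  -- Raising N and n together adds the factor 1 - Q^(N+1) at the front of the product and leaves the
  -- others in place; q^(8n+5) accounts for the change of exponent.
  φ-suc : ∀ N n → φ (suc N) (suc n) ≋ - (q ^ 5 * y n ^ 4 * (1# - Q * w N)) * φ N n
  φ-suc N zero    = φ-base q (Q * w N)
  φ-suc N (suc n) = R.trans (congˡ (φ-suc N n)) (φ-step q (y n) (w N) (φ N n))

  φ-mod : ∀ N n → φ N n ≋ 0# mod n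
  φ-mod N zero    = ⌊ (λ _ ()) ⌋
  φ-mod N (suc n) = mod-*-+ (mod-1 (- (q ^ 5 * (y n ^ 4 - w N))) refl) (φ-mod N n)

  φ-limit : ∀ N n → φ N n ≋ e 0 n mod N
  φ-limit N zero    = mod-refl
  φ-limit N (suc n) = mod-* (mod-neg (mod-trans (mod-* mod-refl (mod-+0 (mod-neg0 (w-mod N))))
    (≋⇒mod (R.sym (R.trans (congˡ (1^ 2)) (R.*-identityʳ _)))))) (φ-limit N n)

  φ-vanish : ∀ n → φ 0 (suc n) ≋ 0#
  φ-vanish zero    = R.trans (R.*-identityʳ _) (R.trans (R.-‿cong (R.trans (congˡ
    (R.trans (R.+-cong (1^ 4) R.refl) (R.-‿inverseʳ 1#))) (R.zeroʳ (q ^ 5)))) ⌊ (λ _ → refl) ⌋)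
  φ-vanish (suc n) = R.trans (congˡ (φ-vanish n)) (R.zeroʳ _)

  -- The terms j = -n and j = n + 1 share a binomial coefficient and are paired. Once n > N, `φ N n`
  -- contains the factor 1 - Q^0, so the sum over n is finite.
  τ : ℕ → ℕ → ℤ⟦q⟧
  τ N n = φ N n * (1# - q ^ 3 * y n ^ 3) * P⁻¹ (suc (n ℕ.+ N))

  τ-mod : ∀ N n → τ N n ≋ 0# mod n
  τ-mod N n = mod-*ˡ (P⁻¹ (suc (n ℕ.+ N))) (mod-*ˡ (1# - q ^ 3 * y n ^ 3) (φ-mod N n))

  -- The finite triple product, with each Gaussian binomial coefficient
  -- [2N+1, N-n] divided by (Q;Q)_(2N+1) / (Q;Q)_N.

  Z : ℕ → ℤ⟦q⟧
  Z N = ∑∞ (τ N)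

  -- B was found, like W, by solving triple-step for it in powers of y.

  B : (q w y : ℤ⟦q⟧) → ℤ⟦q⟧
  B q w y = q ^ 5 * w * (1# - q ^ 11 * w) * (1# - q ^ 14 * y ^ 7)
          - q ^ 14 * w * y ^ 3 * (1# - q ^ 5 * w) * (1# - q ^ 2 * y)

  :B : ∀ {n} (q w y : Polynomial (ℕ.suc n)) → Polynomial (ℕ.suc n)
  :B q w y = q :^ 5 :* w :* (one :- q :^ 11 :* w) :* (one :- q :^ 14 :* y :^ 7)
          :- q :^ 14 :* w :* y :^ 3 :* (one :- q :^ 5 :* w) :* (one :- q :^ 2 :* y)

  -- The telescoping identity for summand n + 1 of `Z`, with `φ` for `φ N n` and `σ` for
  -- `P⁻¹ (3 + n + N)`.
  triple-step : ∀ φ σ q w y →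
    (1# - q ^ 8 * (q ^ 8 * (w * w))) * (1# - q ^ 8 * (q ^ 8 * (q ^ 8 * (w * w))))
      * (- (q ^ 5 * y ^ 4 * (1# - q ^ 8 * w)) * φ * (1# - q ^ 3 * (q ^ 2 * y) ^ 3) * σ)
    ≋ (1# - q ^ 8 * w) * ((1# - q ^ 3 * (q ^ 8 * w)) * (1# - q ^ 5 * w))
      * (- (q ^ 5 * (y ^ 4 - w)) * φ * (1# - q ^ 3 * (q ^ 2 * y) ^ 3)
        * ((1# - q ^ 8 * (q ^ 8 * (q ^ 8 * (y ^ 4 * w)))) * σ))
    + ((1# - q ^ 8 * w) * B q w (q ^ 2 * y) * (- (q ^ 5 * (y ^ 4 - w)) * φ) * σ
      - (1# - q ^ 8 * w) * B q w y * φ * ((1# - q ^ 8 * (q ^ 8 * (q ^ 8 * (y ^ 4 * w)))) * σ))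
  triple-step = solve 5 (λ φ σ q w y →
    let v = one :- q :^ 3 :* (q :^ 2 :* y) :^ 3
        g = one :- q :^ 8 :* w
        k = one :- q :^ 8 :* (q :^ 8 :* (q :^ 8 :* (y :^ 4 :* w)))
        d = :- (q :^ 5 :* (y :^ 4 :- w)) :* φ
    in
    (one :- q :^ 8 :* (q :^ 8 :* (w :* w))) :* (one :- q :^ 8 :* (q :^ 8 :* (q :^ 8 :* (w :* w))))
      :* (:- (q :^ 5 :* y :^ 4 :* g) :* φ :* v :* σ)
    := g :* ((one :- q :^ 3 :* (q :^ 8 :* w)) :* (one :- q :^ 5 :* w)) :* (d :* v :* (k :* σ))
    :+ (g :* :B q w (q :^ 2 :* y) :* d :* σ :- g :* :B q w y :* φ :* (k :* σ))) R.refl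

  triple-base : ∀ σ q w →
    (1# - q ^ 8 * (q ^ 8 * (w * w))) * (1# - q ^ 8 * (q ^ 8 * (q ^ 8 * (w * w))))
      * (1# * (1# - q ^ 3 * 1# ^ 3) * σ)
    ≋ (1# - q ^ 8 * w) * ((1# - q ^ 3 * (q ^ 8 * w)) * (1# - q ^ 5 * w))
      * (1# * (1# - q ^ 3 * 1# ^ 3) * ((1# - q ^ 8 * (q ^ 8 * w)) * σ))
    + (1# - q ^ 8 * w) * B q w 1# * 1# * σ
  triple-base = solve 3 (λ σ q w →
    let v = one :- q :^ 3 :* one :^ 3
        g = one :- q :^ 8 :* w
    in
    (one :- q :^ 8 :* (q :^ 8 :* (w :* w))) :* (one :- q :^ 8 :* (q :^ 8 :* (q :^ 8 :* (w :* w))))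
      :* (one :* v :* σ)
    := g :* ((one :- q :^ 3 :* (q :^ 8 :* w)) :* (one :- q :^ 5 :* w))
      :* (one :* v :* ((one :- q :^ 8 :* (q :^ 8 :* w)) :* σ))
    :+ g :* :B q w one :* one :* σ) R.refl

  -- The coefficients are the factors by which the products in `Z-product` grow from N to N + 1. The
  -- proof telescopes with certificate `V`.
  Z-suc : ∀ N →
    (1# - Q * (Q * (w N * w N))) * (1# - Q * (Q * (Q * (w N * w N)))) * Z (suc N)
    ≋ (1# - Q * w N) * ((1# - q ^ 3 * (Q * w N)) * (1# - q ^ 5 * w N)) * Z N
  Z-suc N = R.trans (R.sym (∑∞-* α (τ-mod (suc N))))
    (R.trans (∑∞-telescope R.refl V-mod step) (∑∞-* β (τ-mod N)))
    where
    α β x : ℤ⟦q⟧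
    x = w N
    α = (1# - Q * (Q * (x * x))) * (1# - Q * (Q * (Q * (x * x))))
    β = (1# - Q * x) * ((1# - q ^ 3 * (Q * x)) * (1# - q ^ 5 * x))
    V : ℕ → ℤ⟦q⟧
    -- `V (suc n)` is built on `φ N n`, so the value at 0 is set separately and `triple-base` treats
    -- the first summand.
    V zero    = 0#
    V (suc n) = (1# - Q * x) * B q x (y n) * φ N n * P⁻¹ (suc (suc (n ℕ.+ N)))
    V-mod : ∀ n → V n ≋ 0# mod n
    V-mod zero    = ⌊ (λ _ ()) ⌋
    V-mod (suc n) = mod-*ˡ (P⁻¹ (suc (suc (n ℕ.+ N))))
      -- `B` is divisible by q, which supplies the one order that `φ N n` lacks.
      (mod-*-+ (mod-*ʳ (1# - Q * x) (mod-1 (B q x (y n)) refl)) (φ-mod N n))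
    step : ∀ n → α * τ (suc N) n ≋ β * τ N n + (V (suc n) - V n)
    step zero = R.trans (triple-base (P⁻¹ (suc (suc N))) q x)
      (R.+-cong (congˡ (congˡ (R.sym (P⁻¹-suc (suc N)))))
        (R.sym (R.trans (R.+-cong R.refl ⌊ (λ _ → refl) ⌋) (R.+-identityʳ (V 1)))))
    step (suc n) = R.trans
      (congˡ (R.*-cong (congʳ (φ-suc N n)) (R.reflexive (cong (λ m → P⁻¹ (suc (suc m))) (ℕ.+-suc n N)))))
      (R.trans (triple-step (φ N n) (P⁻¹ (suc (suc (suc (n ℕ.+ N))))) q x (y n))
        (R.sym (R.+-cong (congˡ (congˡ P₂)) (-congʳ (congˡ P₂)))))
      where
      P₂ : P⁻¹ (suc (suc (n ℕ.+ N))) ≋ (1# - Q * (Q * (Q * (y n ^ 4 * x)))) * P⁻¹ (suc (suc (suc (n ℕ.+ N))))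
      P₂ = R.trans (P⁻¹-suc (suc (suc (n ℕ.+ N))))
        (congʳ (-congʳ (congˡ (congˡ (congˡ (w-+ n N))))))

  move-in : ∀ a b p z → b * (a * p) * z ≋ p * (a * b * z)
  move-in = solve 4 (λ a b p z → b :* (a :* p) :* z := p :* (a :* b :* z)) R.refl

  move-out : ∀ p a b c z → p * (a * (b * c) * z) ≋ a * (b * c) * (p * z)
  move-out = solve 5 (λ p a b c z → p :* (a :* (b :* c) :* z) := a :* (b :* c) :* (p :* z)) R.refl

  distribute : ∀ a b c p f g → a * (b * c) * (p * (f * g)) ≋ a * p * (b * f * (c * g))
  distribute = solve 6 (λ a b c p f g →
    a :* (b :* c) :* (p :* (f :* g)) := a :* p :* (b :* f :* (c :* g))) R.refl

  Z-head : ∀ q p s → p * (1# * (1# - q ^ 3 * 1# ^ 3) * s) ≋ p * s * (1# * ((1# - q ^ 3 * 1#) * 1# * 1#))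
  Z-head = solve 3 (λ q p s →
    p :* (one :* (one :- q :^ 3 :* one :^ 3) :* s)
    := p :* s :* (one :* ((one :- q :^ 3 :* one) :* one :* one))) R.refl

  -- The 2N + 2 terms, j from -N to N + 1, correspond to 2N + 1 factors, whence the unequal lengths
  -- N + 1 and N.
  Z-product : ∀ N → P (suc (N ℕ.+ N)) * Z N ≋ P N * (⟨ q ^ 3 ⨾ Q ⟩ (suc N) * ⟨ q ^ 5 ⨾ Q ⟩ N)
  Z-product zero = R.trans (congˡ Z₀)
    (R.trans (Z-head q (P 1) (P⁻¹ 1)) (R.trans (congʳ (P*P⁻¹ 1)) (R.*-identityˡ _)))
    where
    Z₀ : Z 0 ≋ τ 0 0
    Z₀ = mod⇒≋ λ N → ∑∞-head λ n → ≋⇒mod (R.trans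
      (congʳ (R.trans (congʳ (φ-vanish n)) (R.zeroˡ _))) (R.zeroˡ _))
  Z-product (suc N) rewrite ℕ.+-suc N N = begin
    (1# - Q * (Q * (Q * w (N ℕ.+ N)))) * ((1# - Q * (Q * w (N ℕ.+ N))) * P (suc (N ℕ.+ N))) * Z (suc N)
      ≈⟨ congʳ (R.*-cong (-congʳ (congˡ (congˡ (congˡ (^-+ Q N N)))))
          (congʳ (-congʳ (congˡ (congˡ (^-+ Q N N)))))) ⟩
    (1# - Q * (Q * (Q * (w N * w N)))) * ((1# - Q * (Q * (w N * w N))) * P (suc (N ℕ.+ N))) * Z (suc N)
      ≈⟨ move-in _ _ (P (suc (N ℕ.+ N))) (Z (suc N)) ⟩
    P (suc (N ℕ.+ N)) * ((1# - Q * (Q * (w N * w N))) * (1# - Q * (Q * (Q * (w N * w N)))) * Z (suc N))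
      ≈⟨ congˡ (Z-suc N) ⟩
    P (suc (N ℕ.+ N)) * ((1# - Q * w N) * ((1# - q ^ 3 * (Q * w N)) * (1# - q ^ 5 * w N)) * Z N)
      ≈⟨ move-out _ _ _ _ (Z N) ⟩
    (1# - Q * w N) * ((1# - q ^ 3 * (Q * w N)) * (1# - q ^ 5 * w N)) * (P (suc (N ℕ.+ N)) * Z N)
      ≈⟨ congˡ (Z-product N) ⟩
    (1# - Q * w N) * ((1# - q ^ 3 * (Q * w N)) * (1# - q ^ 5 * w N))
      * (P N * (⟨ q ^ 3 ⨾ Q ⟩ (suc N) * ⟨ q ^ 5 ⨾ Q ⟩ N))
      ≈⟨ distribute _ _ _ (P N) _ _ ⟩
    P (suc N) * (⟨ q ^ 3 ⨾ Q ⟩ (suc (suc N)) * ⟨ q ^ 5 ⨾ Q ⟩ (suc N)) ∎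

  P∞ : ℤ⟦q⟧
  P∞ = ⟨ Q ⨾ Q ⟩∞

  τ-limit : ∀ p φ v s → p * (φ * v * s) ≋ p * s * (φ * v)
  τ-limit = solve 4 (λ p φ v s → p :* (φ :* v :* s) := p :* s :* (φ :* v)) R.refl

  -- Modulo q^N, `φ N n` agrees with `e 0 n`, and `P∞` cancels `P⁻¹ (suc (n + N))`.
  P∞*Z : ∀ N → P∞ * Z N ≋ K 0 mod N
  P∞*Z N = mod-trans (≋⇒mod (R.sym (∑∞-* P∞ (τ-mod N)))) (mod-trans (∑∞-cong-mod term) (≋⇒mod (R.sym K₀)))
    where
    term : ∀ n → P∞ * τ N n ≋ e 0 n * (1# - q ^ 3 * y n ^ 3) mod N
    term n = mod-trans
      (≋⇒mod (τ-limit P∞ (φ N n) (1# - q ^ 3 * y n ^ 3) (P⁻¹ (suc (n ℕ.+ N)))))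
      (mod-trans (mod-* (mod-trans
        (mod-* (mod-sym (⟨⨾⟩-mod Q refl (ℕ.m≤n+m N (suc n)))) mod-refl) (≋⇒mod (P*P⁻¹ (suc (n ℕ.+ N)))))
        (mod-* (φ-limit N n) mod-refl))
      (≋⇒mod (R.*-identityˡ _)))

  triple-product : K 0 ≋ P∞ * (⟨ q ^ 3 ⨾ Q ⟩∞ * ⟨ q ^ 5 ⨾ Q ⟩∞)
  triple-product = mod⇒≋ λ N → mod-trans (mod-sym (P∞*Z N))
    (mod-trans (mod-* (mod-sym (⟨⨾⟩-mod Q refl (ℕ.m≤n⇒m≤1+n (ℕ.m≤m+n N N)))) mod-refl)
    (mod-trans (≋⇒mod (Z-product N))
    (mod-* (⟨⨾⟩-mod Q refl ℕ.≤-refl)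
      (mod-* (⟨⨾⟩-mod (q ^ 3) refl (ℕ.n≤1+n N)) (⟨⨾⟩-mod (q ^ 5) refl ℕ.≤-refl)))))

  -- Collecting the infinite products.

  -- The two products collect the even-indexed and the odd-indexed factors of (a;t)_∞. Taking `b`
  -- and `u` up to `≋` lets literal powers of q be used.
  ⟨⨾⟩∞-dissection : ∀ a {b} t {u} → coeff t 0 ≡ 0ℤ → coeff u 0 ≡ 0ℤ → b ≋ a * t → u ≋ t * t →
    ⟨ a ⨾ u ⟩∞ * ⟨ b ⨾ u ⟩∞ ≋ ⟨ a ⨾ t ⟩∞
  ⟨⨾⟩∞-dissection a {b} t {u} t₀ u₀ b≋at u≋t² = mod⇒≋ λ N → mod-trans
    (mod-sym (mod-* (⟨⨾⟩-mod a u₀ ℕ.≤-refl) (⟨⨾⟩-mod b u₀ ℕ.≤-refl)))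
    (mod-trans (≋⇒mod (finite N)) (⟨⨾⟩-mod a t₀ (ℕ.m≤m+n N N)))
    where
    power : ∀ n → u ^ n ≋ t ^ (n ℕ.+ n)
    power zero    = R.refl
    power (suc n) rewrite ℕ.+-suc n n = R.trans (R.*-cong u≋t² (power n)) (R.*-assoc t t (t ^ (n ℕ.+ n)))
    finite : ∀ n → ⟨ a ⨾ u ⟩ n * ⟨ b ⨾ u ⟩ n ≋ ⟨ a ⨾ t ⟩ (n ℕ.+ n)
    finite zero    = R.*-identityˡ 1#
    finite (suc n) rewrite ℕ.+-suc n n = begin
      (1# - a * u ^ n) * ⟨ a ⨾ u ⟩ n * ((1# - b * u ^ n) * ⟨ b ⨾ u ⟩ n)
        ≈⟨ R.*-cong (congʳ (-congʳ (congˡ (power n))))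
             (congʳ (-congʳ (R.*-cong b≋at (power n)))) ⟩
      (1# - a * T) * ⟨ a ⨾ u ⟩ n * ((1# - a * t * T) * ⟨ b ⨾ u ⟩ n)
        ≈⟨ solve 5 (λ a t T x y →
             (one :- a :* T) :* x :* ((one :- a :* t :* T) :* y)
             := (one :- a :* (t :* T)) :* ((one :- a :* T) :* (x :* y))) R.refl a t T _ _ ⟩
      (1# - a * (t * T)) * ((1# - a * T) * (⟨ a ⨾ u ⟩ n * ⟨ b ⨾ u ⟩ n))
        ≈⟨ congˡ (congˡ (finite n)) ⟩
      (1# - a * (t * T)) * ((1# - a * T) * ⟨ a ⨾ t ⟩ (n ℕ.+ n)) ∎
      where
      T : ℤ⟦q⟧
      T = t ^ (n ℕ.+ n)

  difference-of-squares : ∀ a b p r →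
    (1# - - a * b) * p * ((1# - a * b) * r) ≋ (1# - a * a * (b * b)) * (p * r)
  difference-of-squares = solve 4 (λ a b p r →
    (one :- :- a :* b) :* p :* ((one :- a :* b) :* r) := (one :- a :* a :* (b :* b)) :* (p :* r)) R.refl

  ⟨⨾⟩∞-squares : ∀ a {b} t {u} → coeff t 0 ≡ 0ℤ → coeff u 0 ≡ 0ℤ → b ≋ a * a → u ≋ t * t →
    ⟨ - a ⨾ t ⟩∞ * ⟨ a ⨾ t ⟩∞ ≋ ⟨ b ⨾ u ⟩∞
  ⟨⨾⟩∞-squares a {b} t {u} t₀ u₀ b≋a² u≋t² = mod⇒≋ λ N → mod-trans
    (mod-sym (mod-* (⟨⨾⟩-mod (- a) t₀ ℕ.≤-refl) (⟨⨾⟩-mod a t₀ ℕ.≤-refl)))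
    (mod-trans (≋⇒mod (finite N)) (⟨⨾⟩-mod b u₀ ℕ.≤-refl))
    where
    power : ∀ n → u ^ n ≋ t ^ n * t ^ n
    power zero    = R.sym (R.*-identityˡ 1#)
    power (suc n) = R.trans (R.*-cong u≋t² (power n)) (product-interchange t t (t ^ n) (t ^ n))
    finite : ∀ n → ⟨ - a ⨾ t ⟩ n * ⟨ a ⨾ t ⟩ n ≋ ⟨ b ⨾ u ⟩ n
    finite zero    = R.*-identityˡ 1#
    finite (suc n) = R.trans (difference-of-squares a (t ^ n) (⟨ - a ⨾ t ⟩ n) (⟨ a ⨾ t ⟩ n))
      (R.*-cong (-congʳ (R.sym (R.*-cong b≋a² (power n)))) (finite n))

  X : ℤ⟦q⟧
  X = ⟨ q ⨾ Q ⟩∞ * ⟨ q ^ 4 ⨾ Q ⟩∞ * ⟨ q ^ 7 ⨾ Q ⟩∞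

  -- The residues 1, 3, 5, 7 modulo 8 combine to (q;q²)_∞, which with `o∞` gives (q²;q⁴)_∞; the
  -- residues 4 and 0 combine to (q⁴;q⁴)_∞.
  o∞*K₀*X≋p∞ : o∞ * (P∞ * (⟨ q ^ 3 ⨾ Q ⟩∞ * ⟨ q ^ 5 ⨾ Q ⟩∞)) * X ≋ p∞
  o∞*K₀*X≋p∞ = begin
    o∞ * (P∞ * (⟨ q ^ 3 ⨾ Q ⟩∞ * ⟨ q ^ 5 ⨾ Q ⟩∞)) * X
      ≈⟨ solve 7 (λ o P a b c d e → o :* (P :* (b :* d)) :* (a :* c :* e)
           := o :* (a :* d :* (b :* e)) :* (c :* P)) R.refl o∞ P∞ _ _ _ _ _ ⟩
    o∞ * (⟨ q ⨾ Q ⟩∞ * ⟨ q ^ 5 ⨾ Q ⟩∞ * (⟨ q ^ 3 ⨾ Q ⟩∞ * ⟨ q ^ 7 ⨾ Q ⟩∞)) * (⟨ q ^ 4 ⨾ Q ⟩∞ * P∞)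
      ≈⟨ R.*-cong (congˡ (R.*-cong
           (⟨⨾⟩∞-dissection q (q ^ 4) refl refl R.refl (pow 4 4))
           (⟨⨾⟩∞-dissection (q ^ 3) (q ^ 4) refl refl (pow 3 4) (pow 4 4))))
         (⟨⨾⟩∞-dissection (q ^ 4) (q ^ 4) refl refl (pow 4 4) (pow 4 4)) ⟩
    o∞ * (⟨ q ⨾ q ^ 4 ⟩∞ * ⟨ q ^ 3 ⨾ q ^ 4 ⟩∞) * ⟨ q ^ 4 ⨾ q ^ 4 ⟩∞
      ≈⟨ congʳ (congˡ (⟨⨾⟩∞-dissection q (q ^ 2) refl refl R.refl (pow 2 2))) ⟩
    o∞ * ⟨ q ⨾ q ^ 2 ⟩∞ * ⟨ q ^ 4 ⨾ q ^ 4 ⟩∞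
      ≈⟨ congʳ (⟨⨾⟩∞-squares q (q ^ 2) refl refl (congˡ (R.*-identityʳ q)) (pow 2 2)) ⟩
    ⟨ q ^ 2 ⨾ q ^ 4 ⟩∞ * ⟨ q ^ 4 ⨾ q ^ 4 ⟩∞
      ≈⟨ ⟨⨾⟩∞-dissection (q ^ 2) (q ^ 2) refl refl (pow 2 2) (pow 2 2) ⟩
    p∞ ∎
    where
    pow = ^-+ q

  S₀*X : S 0 * X ≋ 1#
  S₀*X = begin
    S 0 * X                                ≈⟨ R.*-identityʳ _ ⟨
    S 0 * X * 1#                           ≈⟨ congˡ p∞*s∞ ⟨
    S 0 * X * (p∞ * recip p∞)              ≈⟨ solve 4 (λ S X p s → S :* X :* (p :* s) := p :* S :* X :* s)
                                                R.refl (S 0) X p∞ (recip p∞) ⟩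
    p∞ * S 0 * X * recip p∞                ≈⟨ congʳ (congʳ (R.trans (R.sym o∞*K≋p∞*S)
                                                (congˡ triple-product))) ⟩
    o∞ * (P∞ * (⟨ q ^ 3 ⨾ Q ⟩∞ * ⟨ q ^ 5 ⨾ Q ⟩∞)) * X * recip p∞
                                           ≈⟨ congʳ o∞*K₀*X≋p∞ ⟩
    p∞ * recip p∞                          ≈⟨ p∞*s∞ ⟩
    1#                                     ∎
    where
    p∞*s∞ : p∞ * recip p∞ ≋ 1#
    p∞*s∞ = recip-inverse p∞ (D.⟨⨾⟩∞-constant (coeff (q ^ 2)) (coeff (q ^ 2)) refl)

  S₀≋1/X : S 0 ≋ 1# / (⟨ q ⨾ q ^ 8 ⟩∞ * ⟨ q ^ 4 ⨾ q ^ 8 ⟩∞ * ⟨ q ^ 7 ⨾ q ^ 8 ⟩∞)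
  S₀≋1/X = inverse-unique X (S 0) (1# / X) (R.trans (R.*-comm X (S 0)) S₀*X)
    (R.trans (congˡ (R.*-identityˡ (recip X))) (recip-inverse X X₀))
    where
    X₀ : coeff X 0 ≡ 1ℤ
    X₀ = D.*-constant (coeff (⟨ q ⨾ Q ⟩∞ * ⟨ q ^ 4 ⨾ Q ⟩∞)) (coeff ⟨ q ^ 7 ⨾ Q ⟩∞)
      (D.*-constant (coeff ⟨ q ⨾ Q ⟩∞) (coeff ⟨ q ^ 4 ⨾ Q ⟩∞)
        (D.⟨⨾⟩∞-constant (coeff q) (coeff Q) refl) (D.⟨⨾⟩∞-constant (coeff (q ^ 4)) (coeff Q) refl))
      (D.⟨⨾⟩∞-constant (coeff (q ^ 7)) (coeff Q) refl)

  -- Translation back to coefficient sequences.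

  coeff-S₀ : coeff (S 0) D.≈ D.∑∞ (λ n →
    D.⟨ D.- D.q ⨾ D.q D.^ 2 ⟩ n D.* D.q D.^ (n ℕ.^ 2) D./ D.⟨ D.q D.^ 2 ⨾ D.q D.^ 2 ⟩ n)
  coeff-S₀ k = trans (at (∑∞-cong (λ n → R.*-identityʳ (γ n))) k)
    (cong (λ g → g k) (∑<-cong′ (suc k)))
    where
    summand : ℕ → D.Series
    summand n = D.⟨ D.- D.q ⨾ D.q D.^ 2 ⟩ n D.* D.q D.^ (n ℕ.^ 2) D./ D.⟨ D.q D.^ 2 ⨾ D.q D.^ 2 ⟩ n
    poch : ∀ a n → coeff (⟨ a ⨾ q ^ 2 ⟩ n) ≡ D.⟨ coeff a ⨾ D.q D.^ 2 ⟩ n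
    poch a n = trans (coeff-⟨⨾⟩ a (q ^ 2) n) (cong (λ t → D.⟨ coeff a ⨾ t ⟩ n) (coeff-^ q 2))
    summand-≡ : ∀ n → coeff (γ n) ≡ summand n
    summand-≡ n = cong₂ D._*_ (cong₂ D._*_ (poch (- q) n) (coeff-^ q (n ℕ.^ 2)))
      (cong D.recip (trans (poch (q ^ 2) n) (cong (λ a → D.⟨ a ⨾ D.q D.^ 2 ⟩ n) (coeff-^ q 2))))
    ∑<-cong′ : ∀ n → D.∑< (λ n → coeff (γ n)) n ≡ D.∑< summand n
    ∑<-cong′ zero    = refl
    ∑<-cong′ (suc n) = cong₂ D._+_ (∑<-cong′ n) (summand-≡ n)

  coeff-quotient : ∀ a b c t {a′ b′ c′ t′} → coeff a ≡ a′ → coeff b ≡ b′ → coeff c ≡ c′ → coeff t ≡ t′ →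
    coeff (1# / (⟨ a ⨾ t ⟩∞ * ⟨ b ⨾ t ⟩∞ * ⟨ c ⨾ t ⟩∞))
    ≡ D.1# D./ (D.⟨ a′ ⨾ t′ ⟩∞ D.* D.⟨ b′ ⨾ t′ ⟩∞ D.* D.⟨ c′ ⨾ t′ ⟩∞)
  coeff-quotient a b c t refl refl refl refl = refl

  coeff-q^ : ∀ n → coeff (q ^ n) ≡ D.q D.^ n
  coeff-q^ zero    = refl
  coeff-q^ (suc n) = cong (D.q D.*_) (coeff-q^ n)

  -- With 4, 7 and 8 in place of b, c and t, conversion checking would unfold
  -- the powers of q.

  coeff-quotient-q^ : ∀ b c t →
    coeff (1# / (⟨ q ⨾ q ^ t ⟩∞ * ⟨ q ^ b ⨾ q ^ t ⟩∞ * ⟨ q ^ c ⨾ q ^ t ⟩∞)) ≡ D.1# D./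
    (D.⟨ D.q ⨾ D.q D.^ t ⟩∞ D.* D.⟨ D.q D.^ b ⨾ D.q D.^ t ⟩∞ D.* D.⟨ D.q D.^ c ⨾ D.q D.^ t ⟩∞)
  coeff-quotient-q^ b c t = coeff-quotient q (q ^ b) (q ^ c) (q ^ t) {D.q} {D.q D.^ b} {D.q D.^ c} {D.q D.^ t}
    refl (coeff-q^ b) (coeff-q^ c) (coeff-q^ t)

  coeff-1/X : coeff (1# / (⟨ q ⨾ q ^ 8 ⟩∞ * ⟨ q ^ 4 ⨾ q ^ 8 ⟩∞ * ⟨ q ^ 7 ⨾ q ^ 8 ⟩∞)) ≡ D.1# D./
    (D.⟨ D.q ⨾ D.q D.^ 8 ⟩∞ D.* D.⟨ D.q D.^ 4 ⨾ D.q D.^ 8 ⟩∞ D.* D.⟨ D.q D.^ 7 ⨾ D.q D.^ 8 ⟩∞)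
  coeff-1/X = coeff-quotient-q^ 4 7 8

  -- Partitions classified by their smallest part.

  -- Recursive, so that `double (suc i)` computes to `suc (suc (double i))` and bounds on parts
  -- match by conversion.
  double : ℕ → ℕ
  double zero    = zero
  double (suc n) = suc (suc (double n))

  2∣double : ∀ n → 2 ∣ double n
  2∣double zero    = 2 ∣0
  2∣double (suc n) = ∣m∣n⇒∣m+n ∣-refl (2∣double n)

  n≤double : ∀ n → n ℕ.≤ double n
  n≤double zero    = z≤n
  n≤double (suc n) = s≤s (ℕ.m≤n⇒m≤1+n (n≤double n))

  q^double : ∀ n → q ^ double n ≋ y n
  q^double zero    = R.refl
  q^double (suc n) = R.trans (square-step q (q ^ double n)) (congˡ (q^double n))

  -- A transitive relation that encodes the conditions on consecutive parts.

  Gap : ℕ → ℕ → Set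
  Gap a b = 2 ℕ.+ b ℕ.≤ a × (2 ∣ b → 3 ℕ.+ b ℕ.≤ a)

  Gap⇒≥ : ∀ {a b} → Gap a b → a ℕ.≥ b
  Gap⇒≥ (2+b≤a , _) = ℕ.≤-trans (ℕ.m≤n+m _ 2) 2+b≤a

  Gap-trans : ∀ {a b c} → Gap a b → Gap b c → Gap a c
  Gap-trans (2+b≤a , _) (2+c≤b , _) = ℕ.≤-trans (ℕ.m≤n+m _ 2) 4+c≤a , λ _ → ℕ.≤-trans (ℕ.n≤1+n _) 4+c≤a
    where 4+c≤a = ℕ.≤-trans (s≤s (s≤s 2+c≤b)) 2+b≤a

  distance : ∀ {a b} → a ℕ.≥ b → ∣ a - b ∣ ≡ a ℕ.∸ b
  distance = ℕ.m≤n⇒∣n-m∣≡n∸m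

  distance⁻ : ∀ d {a b} → a ℕ.≥ b → d ℕ.≤ ∣ a - b ∣ → d ℕ.+ b ℕ.≤ a
  distance⁻ d a≥b p = ℕ.m≤o∸n⇒m+n≤o d a≥b (subst (d ℕ.≤_) (distance a≥b) p)

  distance⁺ : ∀ d {a b} → a ℕ.≥ b → d ℕ.+ b ℕ.≤ a → d ℕ.≤ ∣ a - b ∣
  distance⁺ d a≥b p = subst (d ℕ.≤_) (sym (distance a≥b)) (ℕ.m+n≤o⇒m≤o∸n d p)

  -- For even `b`, a difference of exactly 2 would make `a` even too, against the bound 4.
  Gap⁺ : ∀ {a b} → a ℕ.≥ b → 2 ℕ.≤ ∣ a - b ∣ → (2 ∣ a → 2 ∣ b → 4 ℕ.≤ ∣ a - b ∣) → Gap a b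
  Gap⁺ {a} {b} a≥b d₂ d₄ = 2+b≤a , λ 2∣b → ℕ.≤∧≢⇒< 2+b≤a λ 2+b≡a →
    let 2∣a = subst (2 ∣_) 2+b≡a (∣m∣n⇒∣m+n ∣-refl 2∣b)
    in ℕ.<⇒≱ (ℕ.<-≤-trans (ℕ.n<1+n (2 ℕ.+ b)) (ℕ.n≤1+n _))
         (subst (4 ℕ.+ b ℕ.≤_) (sym 2+b≡a) (distance⁻ 4 a≥b (d₄ 2∣a 2∣b)))
    where 2+b≤a = distance⁻ 2 a≥b d₂

  -- Two even numbers cannot differ by 3, so the bound 3 improves to 4.
  Gap⁻ : ∀ {a b} → Gap a b → 2 ∣ a → 2 ∣ b → 4 ℕ.≤ ∣ a - b ∣
  Gap⁻ {b = b} g@(_ , g₃) 2∣a 2∣b = distance⁺ 4 (Gap⇒≥ g) (ℕ.≤∧≢⇒< (g₃ 2∣b) λ 3+b≡a →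
    from-no (2 ∣? 3) (∣m+n∣m⇒∣n (subst (2 ∣_) (trans (sym 3+b≡a) (ℕ.+-comm 3 b)) 2∣a) 2∣b))

  -- Gaps are imposed on all pairs, which `Gap-trans` permits, so that removing or appending the
  -- smallest part, last in the list, compares it with every other part at once.
  Part : ℕ → ℕ → List ℕ → Set
  Part i n π = AllPairs Gap π × All (double i ℕ.<_) π × sum π ≡ n

  parts : ℕ → ℕ → List (List ℕ)
  parts i n = filter (all? (double i ℕ.<?_)) (filter D.𝒢? (D.partitions n))

  ∈-parts⁻ : ∀ i n {π} → π ∈ parts i n → Part i n π
  ∈-parts⁻ i n π∈ with π∈′ , large ← ∈-filter⁻ (all? (double i ℕ.<?_)) π∈
    with π∈″ , g₂ , g₄ ← ∈-filter⁻ D.𝒢? π∈′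
    with (_ , desc) , Σ ← Equivalence.to (D.∈-partitions n) π∈″ =
      Linked⇒AllPairs Gap-trans (Linked.zipWith (λ (p , r , s) → Gap⁺ p r s) (desc , Linked.zip (g₂ , g₄)))
    , large , Σ

  ∈-parts⁺ : ∀ i n {π} → Part i n π → π ∈ parts i n
  ∈-parts⁺ i n (gaps , large , Σ) = ∈-filter⁺ (all? (double i ℕ.<?_))
    (∈-filter⁺ D.𝒢? (Equivalence.from (D.∈-partitions n)
        ((All.map (ℕ.≤-<-trans z≤n) large , Linked.map Gap⇒≥ linked) , Σ))
      (Linked.map (λ g → distance⁺ 2 (Gap⇒≥ g) (proj₁ g)) linked , Linked.map Gap⁻ linked))
    large
    where linked = AllPairs⇒Linked gaps

  parts-unique : ∀ i n → Unique (parts i n)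
  parts-unique i n = Unique.filter⁺ (all? (double i ℕ.<?_)) (Unique.filter⁺ D.𝒢? (D.partitions-unique n))

  AllPairs-∷ʳ⁺ : ∀ {A : Set} {R : A → A → Set} {xs a} →
    AllPairs R xs → All (λ x → R x a) xs → AllPairs R (xs ∷ʳ a)
  AllPairs-∷ʳ⁺ []       []       = [] ∷ []
  AllPairs-∷ʳ⁺ (p ∷ ps) (g ∷ gs) = All.∷ʳ⁺ p g ∷ AllPairs-∷ʳ⁺ ps gs

  AllPairs-∷ʳ⁻ : ∀ {A : Set} {R : A → A → Set} xs {a} →
    AllPairs R (xs ∷ʳ a) → AllPairs R xs × All (λ x → R x a) xs
  AllPairs-∷ʳ⁻ []       _        = [] , []
  AllPairs-∷ʳ⁻ (x ∷ xs) (p ∷ ps) with p′ , g ← All.∷ʳ⁻ p | ps′ , gs ← AllPairs-∷ʳ⁻ xs ps =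
    p′ ∷ ps′ , g ∷ gs

  sum-∷ʳ : ∀ xs a → sum (xs ∷ʳ a) ≡ a ℕ.+ sum xs
  sum-∷ʳ xs a = trans (sum-++ xs (a ∷ []))
    (trans (cong (sum xs ℕ.+_) (ℕ.+-identityʳ a)) (ℕ.+-comm (sum xs) a))

  -- Multiplication by q^m on families of lists. Below m the list is empty, where truncated
  -- subtraction would yield `F 0`.
  delay : ∀ {A : Set} → ℕ → (ℕ → List A) → ℕ → List A
  delay zero    F n       = F n
  delay (suc m) F zero    = []
  delay (suc m) F (suc n) = delay m F n

  ∈-delay⁻ : ∀ {A : Set} {z : A} m F n → z ∈ delay m F n → ∃[ k ] (m ℕ.+ k ≡ n × z ∈ F k)
  ∈-delay⁻ zero    F n       z∈ = n , refl , z∈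
  ∈-delay⁻ (suc m) F (suc n) z∈ with k , eq , z∈′ ← ∈-delay⁻ m F n z∈ = k , cong suc eq , z∈′

  ∈-delay⁺ : ∀ {A : Set} {z : A} m F {k} → z ∈ F k → z ∈ delay m F (m ℕ.+ k)
  ∈-delay⁺ zero    F z∈ = z∈
  ∈-delay⁺ (suc m) F z∈ = ∈-delay⁺ m F z∈

  delay-unique : ∀ {A : Set} m {F : ℕ → List A} → (∀ n → Unique (F n)) → ∀ n → Unique (delay m F n)
  delay-unique zero    u n       = u n
  delay-unique (suc m) u zero    = []
  delay-unique (suc m) u (suc n) = delay-unique m u n

  generating : ∀ {A : Set} → (ℕ → List A) → ℤ⟦q⟧
  coeff (generating F) n = + length (F n)

  q*-suc : ∀ f n → coeff (q * f) (suc n) ≡ coeff f n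
  q*-suc f n = trans (ℤ.+-identityˡ _) (trans
    (*-cong {tail D.q} {D.1#} {coeff f} (λ { zero → refl ; (suc _) → refl }) (λ _ → refl) n)
    (*-identityˡ (coeff f) n))

  generating-delay : ∀ {A : Set} m (F : ℕ → List A) → generating (delay m F) ≋ q ^ m * generating F
  generating-delay zero    F = R.sym (R.*-identityˡ (generating F))
  generating-delay (suc m) F = R.trans ⌊ shift ⌋ (R.sym (R.*-assoc q (q ^ m) (generating F)))
    where
    shift : ∀ n → coeff (generating (delay (suc m) F)) n ≡ coeff (q * (q ^ m * generating F)) n
    shift zero    = refl
    shift (suc n) = trans (at (generating-delay m F) n) (sym (q*-suc (q ^ m * generating F) n))

  -- Above a smallest part 2i + 1 the next part is at least 2i + 3, so beyond 2(i + 1); above the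
  -- even part 2i + 2 it is at least 2i + 5, so beyond 2(i + 2).
  last-odd : ℕ → ℕ → List (List ℕ)
  last-odd i n = List.map (_∷ʳ suc (double i)) (delay (suc (double i)) (parts (suc i)) n)

  last-even : ℕ → ℕ → List (List ℕ)
  last-even i n = List.map (_∷ʳ suc (suc (double i))) (delay (suc (suc (double i))) (parts (suc (suc i))) n)

  module _ (i n : ℕ) where
    private
      split : List (List ℕ)
      split = parts (suc i) n ++ (last-odd i n ++ last-even i n)

    parts⊆split : ∀ {π} → π ∈ parts i n → π ∈ split
    parts⊆split {π} π∈ with gaps , large , Σ ← ∈-parts⁻ i n π∈ | initLast π
    ... | [] = ∈-++⁺ˡ (∈-parts⁺ (suc i) n ([] , [] , Σ))
    ... | xs ∷ʳ′ a with xs-gaps , last-gaps ← AllPairs-∷ʳ⁻ xs gaps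
      with a ℕ.≟ suc (double i) | a ℕ.≟ suc (suc (double i))
    ...   | yes refl | _ = ∈-++⁺ʳ (parts (suc i) n) (∈-++⁺ˡ (∈-map⁺ (_∷ʳ a)
      (subst (λ m → xs ∈ delay a (parts (suc i)) m) (trans (sym (sum-∷ʳ xs a)) Σ)
        -- Here `2 + a ≤ x` is `double (suc i) < x` by computation; in the even case, `3 + a ≤ x` is
        -- `double (suc (suc i)) < x`.
        (∈-delay⁺ a (parts (suc i)) (∈-parts⁺ (suc i) (sum xs) (xs-gaps , All.map proj₁ last-gaps , refl))))))
    ...   | no _ | yes refl = ∈-++⁺ʳ (parts (suc i) n) (∈-++⁺ʳ (last-odd i n) (∈-map⁺ (_∷ʳ a)
      (subst (λ m → xs ∈ delay a (parts (suc (suc i))) m) (trans (sym (sum-∷ʳ xs a)) Σ)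
        (∈-delay⁺ a (parts (suc (suc i))) (∈-parts⁺ (suc (suc i)) (sum xs)
          (xs-gaps , All.map (λ g → proj₂ g (2∣double (suc i))) last-gaps , refl))))))
    ...   | no a≢₁ | no a≢₂ = ∈-++⁺ˡ (∈-parts⁺ (suc i) n
      (gaps , All.∷ʳ⁺ (All.map (λ g → ℕ.<-≤-trans 2+2i<a (Gap⇒≥ g)) last-gaps) 2+2i<a , Σ))
      where
      2+2i<a : double (suc i) ℕ.< a
      2+2i<a = ℕ.≤∧≢⇒< (ℕ.≤∧≢⇒< (proj₂ (All.∷ʳ⁻ large)) (λ eq → a≢₁ (sym eq))) (λ eq → a≢₂ (sym eq))

    from-large : ∀ {π} → π ∈ parts (suc i) n → π ∈ parts i n
    from-large π∈ with gaps , large , Σ ← ∈-parts⁻ (suc i) n π∈ =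
      ∈-parts⁺ i n (gaps , All.map (ℕ.<-trans (ℕ.m≤n⇒m≤1+n (ℕ.n<1+n (double i)))) large , Σ)

    from-snoc : ∀ a j {π} → double i ℕ.< a → double i ℕ.≤ double j → (∀ {x} → double j ℕ.< x → Gap x a) →
      π ∈ List.map (_∷ʳ a) (delay a (parts j) n) → π ∈ parts i n
    from-snoc a j 2i<a i≤j gap π∈ with xs , xs∈ , refl ← ∈-map⁻ (_∷ʳ a) π∈
      with k , refl , xs∈′ ← ∈-delay⁻ a (parts j) n xs∈
      with gaps , large , Σ ← ∈-parts⁻ j k xs∈′ = ∈-parts⁺ i n
        ( AllPairs-∷ʳ⁺ gaps (All.map gap large)
        , All.∷ʳ⁺ (All.map (ℕ.≤-<-trans i≤j) large) 2i<a
        , trans (sum-∷ʳ xs a) (cong (a ℕ.+_) Σ))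

    from-odd : ∀ {π} → π ∈ last-odd i n → π ∈ parts i n
    -- The clause of `Gap` for even `b` holds vacuously, since 2i + 1 is odd.
    from-odd = from-snoc (suc (double i)) (suc i) ℕ.≤-refl (ℕ.m≤n+m _ 2) λ lt → lt , λ 2∣a →
      contradiction (∣m+n∣m⇒∣n (subst (2 ∣_) (ℕ.+-comm 1 (double i)) 2∣a) (2∣double i)) (from-no (2 ∣? 1))

    from-even : ∀ {π} → π ∈ last-even i n → π ∈ parts i n
    from-even = from-snoc (suc (suc (double i))) (suc (suc i)) (ℕ.n≤1+n _) (ℕ.m≤n+m _ 4)
      λ lt → ℕ.<⇒≤ lt , λ _ → lt

    split⊆parts : ∀ {π} → π ∈ split → π ∈ parts i n
    split⊆parts π∈ with ∈-++⁻ (parts (suc i) n) π∈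
    ... | inj₁ π∈₁ = from-large π∈₁
    ... | inj₂ π∈₂ with ∈-++⁻ (last-odd i n) π∈₂
    ...   | inj₁ π∈₃ = from-odd π∈₃
    ...   | inj₂ π∈₄ = from-even π∈₄

    split-unique : Unique split
    split-unique = Unique.++⁺ (parts-unique (suc i) n)
      (Unique.++⁺
        (∷ʳ-unique (delay-unique (suc (double i)) (parts-unique (suc i)) n))
        (∷ʳ-unique (delay-unique (suc (suc (double i))) (parts-unique (suc (suc i))) n))
        λ (p , r) → odd≠even (∈-map⁻ _ p) (∈-map⁻ _ r))
      λ (p , r) → large≠ (∈-++⁻ (last-odd i n) r) (proj₁ (proj₂ (∈-parts⁻ (suc i) n p)))
      where
      ∷ʳ-unique : ∀ {a} {πs : List (List ℕ)} → Unique πs → Unique (List.map (_∷ʳ a) πs)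
      ∷ʳ-unique = Unique.map⁺ λ {xs} {ys} → List.∷ʳ-injectiveˡ xs ys
      odd≠even : ∀ {π} {A B : List (List ℕ)} → ∃[ xs ] (xs ∈ A × π ≡ xs ∷ʳ suc (double i)) →
        ∃[ ys ] (ys ∈ B × π ≡ ys ∷ʳ suc (suc (double i))) → ⊥
      odd≠even (xs , _ , refl) (ys , _ , eq) = contradiction (List.∷ʳ-injectiveʳ xs ys eq) (ℕ.<⇒≢ ℕ.≤-refl)
      large≠ : ∀ {π} → π ∈ last-odd i n ⊎ π ∈ last-even i n → All (double (suc i) ℕ.<_) π → ⊥
      large≠ (inj₁ r) large with xs , _ , refl ← ∈-map⁻ _ r =
        contradiction (proj₂ (All.∷ʳ⁻ large)) (ℕ.≤⇒≯ (ℕ.n≤1+n _))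
      large≠ (inj₂ r) large with xs , _ , refl ← ∈-map⁻ _ r =
        contradiction (proj₂ (All.∷ʳ⁻ large)) (ℕ.<-irrefl refl)

    -- Both lists are free of duplicates and have the same members, so each is a permutation of the
    -- other.
    parts-length : length (parts i n) ≡ length (parts (suc i) n) ℕ.+
      (length (delay (suc (double i)) (parts (suc i)) n)
        ℕ.+ length (delay (suc (suc (double i))) (parts (suc (suc i))) n))
    parts-length = trans (↭-length (∼bag⇒↭
        (unique∧set⇒bag (parts-unique i n) split-unique (mk⇔ parts⊆split split⊆parts))))
      (trans (List.length-++ (parts (suc i) n)) (cong (length (parts (suc i) n) ℕ.+_)
        (trans (List.length-++ (last-odd i n)) (cong₂ ℕ._+_
          (List.length-map (_∷ʳ suc (double i)) (delay (suc (double i)) (parts (suc i)) n))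
          (List.length-map (_∷ʳ suc (suc (double i))) (delay (suc (suc (double i))) (parts (suc (suc i))) n))))))

  -- The generating functions as a solution.

  G : ℕ → ℤ⟦q⟧
  G i = generating (parts i)

  G-recurrence : Recurrence G
  G-recurrence i = R.trans ⌊ (λ n → cong +_ (parts-length i n)) ⌋ (R.trans
    (R.+-cong R.refl (R.+-cong
      (R.trans (generating-delay (suc (double i)) (parts (suc i))) (congʳ (congˡ (q^double i))))
      (R.trans (generating-delay (suc (suc (double i))) (parts (suc (suc i)))) (congʳ
        (R.trans (square-step q (q ^ double i)) (congˡ (q^double i)))))))
    (solve 5 (λ g h q a b → g :+ (q :* a :* g :+ b :* a :* h) := (one :+ q :* a) :* g :+ b :* a :* h)
      R.refl (G (suc i)) (G (suc (suc i))) q (y i) (q ^ 2)))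

  -- A nonempty partition counted by `G i` has a part exceeding 2i, so below q^i only the empty one
  -- contributes.
  G-limit : ∀ i → G i ≋ 1# mod i
  G-limit i = ⌊ small ⌋
    where
    empty : ∀ k → suc k ℕ.< i → ∀ {π} → ¬ Part i (suc k) π
    empty k k<i {[]}     (_ , _ , ())
    empty k k<i {x ∷ xs} (_ , 2i<x ∷ _ , Σ) = ℕ.<⇒≱ (ℕ.<-trans k<i (ℕ.≤-<-trans (n≤double i) 2i<x))
      (subst (x ℕ.≤_) Σ (ℕ.m≤m+n x (sum xs)))
    small : ∀ k → k ℕ.< i → + length (parts i k) ≡ D.1# k
    small zero    _   = refl
    small (suc k) k<i with parts i (suc k) in eq
    ... | []    = refl
    ... | π ∷ _ = contradiction (∈-parts⁻ i (suc k) (subst (π ∈_) (sym eq) (here refl))) (empty k k<i)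

  -- `double 0` is 0 and parts are positive, so the filter on large parts removes nothing.
  P𝒢≡G₀ : ∀ n → D.P𝒢 n ≡ coeff (G 0) n
  P𝒢≡G₀ n = cong (λ πs → + length πs) (sym (List.filter-all (all? (0 ℕ.<?_)) (All.tabulate λ π∈ →
    proj₁ (proj₁ (Equivalence.to (D.∈-partitions n) (proj₁ (∈-filter⁻ D.𝒢? π∈)))))))

  G≋S : G 0 ≋ S 0
  G≋S = recurrence-unique G-recurrence S-recurrence (λ i → mod-trans (G-limit i) (mod-sym (S-limit i))) 0

open import Defs
open import Data.Nat.Base using () renaming (_^_ to _^ℕ_)

theorem5 : (P𝒢 ≈ ∑∞ (λ n → ⟨ - q ⨾ q ^ 2 ⟩ n * q ^ (n ^ℕ 2) / ⟨ q ^ 2 ⨾ q ^ 2 ⟩ n))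
    × (∑∞ (λ n → ⟨ - q ⨾ q ^ 2 ⟩ n * q ^ (n ^ℕ 2) / ⟨ q ^ 2 ⨾ q ^ 2 ⟩ n)
    ≈ 1# / (⟨ q ⨾ q ^ 8 ⟩∞ * ⟨ q ^ 4 ⨾ q ^ 8 ⟩∞ * ⟨ q ^ 7 ⨾ q ^ 8 ⟩∞))
theorem5 =
    (λ n → trans (P𝒢≡G₀ n) (trans (_≋_.at G≋S n) (coeff-S₀ n)))
  , (λ n → trans (sym (coeff-S₀ n)) (trans (_≋_.at S₀≋1/X n) (cong (λ f → f n) coeff-1/X)))
  where open Development using (module _≋_; P𝒢≡G₀; G≋S; coeff-S₀; S₀≋1/X; coeff-1/X)
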